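{- Let $1\le k\le n-1$, $\gcd(k,n)=1$ with $k$ odd, and let $\psi=\operatorname{MCM}^{ -1}$ be the inverse of the permutation $\operatorname{MCM}$ of $\mathbb{F}_{2^n}$. For $\rho\in\mathbb{F}_{2^n}\setminus\{0,1\}$ and $\sigma=1+\rho$ define $$A(\rho):=\sum_{\substack{(t_1,t_2,t_3)\in\mathbb{F}_{2^n}^3\\ t_1+\rho t_2+\sigma t_3=0}}\chi\bigl(\psi(t_1)+\psi(t_2)+\psi(t_3)\bigr)=\sum_{t,a\in\mathbb{F}_{2^n}}\chi\bigl(\psi(t+\rho a)+\psi(t+a)+\psi(t)\bigr)$$ (the two expressions being equal). Then $8\,Z(\rho)=2^{n}A(\rho)$, and the statement "$N(v_1,v_2)=2^{2n-3}$ for all distinct nonzero $v_1,v_2\in\mathbb{F}_{2^n}$" is equivalent to $$A(\rho)=0\quad\text{for all }\rho\in\mathbb{F}_{2^n}\setminus\{0,1\}.$$ Equivalently, in Fourier form, with $$W_\psi(1,\mu)=\sum_{x\in\mathbb{F}_{2^n}}\chi(\psi(x)+\mu x)=W_{\operatorname{MCM}}(\mu,1)=2S(\mu),$$ one has $$A(\rho)=2^{ -n}\sum_{\mu\in\mathbb{F}_{2^n}}W_\psi(1,\mu)\,W_\psi(1,\mu\rho)\,W_\psi(1,\mu\sigma).$$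
   Context: $\mathbb{F}_{2^n}$ is the field with $2^n$ elements, $\operatorname{Tr}(x)=\sum_{i=0}^{n-1}x^{2^i}$ is the absolute trace, and $\chi(x)=(-1)^{\operatorname{Tr}(x)}$. Put $q=2^k$, $F(x)=x^{4^k-2^k+1}$, $\delta(b)=F(b)+F(b+1)+1$, $\Delta=\{\delta(b): b\in\mathbb{F}_{2^n}\}$, and $S(a)=\sum_{t\in\Delta}\chi(at)$. For distinct nonzero $v_1,v_2\in\mathbb{F}_{2^n}$, $N(v_1,v_2)=|\{(x,y,z)\in\Delta^3: v_1x+v_2y+(v_1+v_2)z=0\}|$. For $\rho\in\mathbb{F}_{2^n}\setminus\{0,1\}$ and $\sigma=1+\rho$, $Z(\rho)=\sum_{\lambda\in\mathbb{F}_{2^n}^{*}}S(\lambda)S(\lambda\rho)S(\lambda\sigma)$. Let $T_k(x)=\sum_{i=0}^{k-1}x^{2^i}$ and let $\operatorname{MCM}(x)=T_k(x)^{q+1}/x^{q}$ be the Müller–Cohen–Matthews polynomial; since $x^q$ divides $T_k(x)^q$ this is a polynomial, and $\operatorname{MCM}(0)=0$. It is a known result (Cohen–Matthews) that for $k$ odd, $\gcd(k,n)=1$, $1\le k<n$, the map $\operatorname{MCM}$ is a permutation of $\mathbb{F}_{2^n}$. Its Walsh coefficient is $W_{\operatorname{MCM}}(\mu,1)=\sum_{y\in\mathbb{F}_{2^n}}\chi(\mu\operatorname{MCM}(y)+y)$.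
   Formalization: The equality W_MCM(μ,1) = 2S(μ) is stated only for μ ≠ 0, since at μ = 0 it fails: W_MCM(0,1) = 0 while 2S(0) = 2|Δ| = 2^n. -}

module Defs where

open import Level using (Level; _⊔_; suc)
open import Algebra.Bundles using (CommutativeRing)
import Algebra.Definitions as AlgebraicDefinitions
import Algebra.Definitions.RawMonoid as RawMonoidDefinitions
import Algebra.Properties.Semiring.Exp as Exp
open import Data.Bool.Base using (if_then_else_)
open import Data.Fin.Base using (Fin; toℕ)
open import Data.Fin.Properties using (any?; inj⇒≟)
open import Data.Integer.Base as ℤ using (ℤ; 0ℤ; -1ℤ)
open import Data.Nat.Base as ℕ using (ℕ)
open import Data.Product.Base using (∃; _,_; proj₁)
open import Function.Base using (_∘_)
open import Function.Bundles using (Inverse)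
open import Function.Properties.Inverse as Inverseₚ using (Inverse⇒Injection)
open import Relation.Binary.Definitions using (Decidable)
import Relation.Binary.PropositionalEquality as ≡
open import Relation.Nullary using (yes; no; does; _×-dec_)
open import Relation.Nullary.Decidable using (map′)
import Relation.Unary as Unary

record FiniteField (c ℓ : Level) (N : ℕ) : Set (suc (c ⊔ ℓ)) where
  field
    commutativeRing : CommutativeRing c ℓ

  open CommutativeRing commutativeRing public
  open AlgebraicDefinitions _≈_ using (Invertible)

  field
    0≉1         : 0# ≉ 1#
    invertible  : ∀ {x} → x ≉ 0# → Invertible 1# _*_ x
    enumeration : Inverse (≡.setoid (Fin N)) setoid

  open Inverse enumeration public using ()
    renaming (to to element; from to index; strictlyInverseˡ to element-index)

  infix 4 _≟_
  _≟_ : Decidable _≈_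
  _≟_ = inj⇒≟ (Inverse⇒Injection (Inverseₚ.sym enumeration))

  infix 8 _⁻¹
  _⁻¹ : Carrier → Carrier
  x ⁻¹ with x ≟ 0#
  ... | yes _  = 0#
  ... | no x≉0 = proj₁ (invertible x≉0)

  -- Each class of _≈_ contributes once to these sums, even if it has
  -- several representatives in Carrier.
  ∑ : (Carrier → ℤ) → ℤ
  ∑ f = sum (f ∘ element)
    where open RawMonoidDefinitions ℤ.+-0-rawMonoid using (sum)

  ∑ℕ : (Carrier → ℕ) → ℕ
  ∑ℕ f = sum (f ∘ element)
    where open RawMonoidDefinitions ℕ.+-0-rawMonoid using (sum)

module Kasami {c ℓ} (n k : ℕ) (𝔽 : FiniteField c ℓ (2 ℕ.^ n)) where
  open FiniteField 𝔽
  open Exp semiring using (_^_; ^-congˡ)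
  open RawMonoidDefinitions +-rawMonoid using (sum)

  q : ℕ
  q = 2 ℕ.^ k

  T : ℕ → Carrier → Carrier
  T m x = sum {m} (λ i → x ^ (2 ℕ.^ toℕ i))

  Tr : Carrier → Carrier
  Tr = T n

  -- Tr x lies in the prime subfield {0, 1}, which is lifted to {0, 1} ⊆ ℕ
  -- to serve as an exponent.
  χ : Carrier → ℤ
  χ x = -1ℤ ℤ.^ (if does (Tr x ≟ 0#) then 0 else 1)

  F : Carrier → Carrier
  F x = x ^ (4 ℕ.^ k ℕ.∸ 2 ℕ.^ k ℕ.+ 1)

  δ : Carrier → Carrier
  δ b = F b + F (b + 1#) + 1#

  δ-cong : ∀ {x y} → x ≈ y → δ x ≈ δ y
  δ-cong x≈y = +-congʳ (+-cong (^-congˡ d x≈y) (^-congˡ d (+-congʳ x≈y)))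
    where d = 4 ℕ.^ k ℕ.∸ 2 ℕ.^ k ℕ.+ 1

  Δ : Unary.Pred Carrier _
  Δ t = ∃ λ b → δ b ≈ t

  Δ? : Unary.Decidable Δ
  Δ? t = map′
    (λ (i , p) → element i , p)
    (λ (b , p) → index b , trans (δ-cong (element-index b)) p)
    (any? λ i → δ (element i) ≟ t)

  S : Carrier → ℤ
  S a = ∑ λ t → if does (Δ? t) then χ (a * t) else 0ℤ

  N : Carrier → Carrier → ℕ
  N v₁ v₂ = ∑ℕ λ x → ∑ℕ λ y → ∑ℕ λ z →
    if does (Δ? x ×-dec Δ? y ×-dec Δ? z ×-dec
             (v₁ * x + v₂ * y + (v₁ + v₂) * z ≟ 0#))
    then 1 else 0

  Z : Carrier → ℤ
  Z ρ = ∑ λ l → if does (l ≟ 0#) then 0ℤ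
                else S l ℤ.* S (l * ρ) ℤ.* S (l * σ)
    where σ = 1# + ρ

  -- The quotient polynomial has no constant term, so it vanishes at 0;
  -- here that value comes from 0 ⁻¹ = 0.
  MCM : Carrier → Carrier
  MCM x = T k x ^ (q ℕ.+ 1) * (x ^ q) ⁻¹

  W : (Carrier → Carrier) → Carrier → Carrier → ℤ
  W f a b = ∑ λ x → χ (a * f x + b * x)

  A : (Carrier → Carrier) → Carrier → ℤ
  A ψ ρ = ∑ λ t₁ → ∑ λ t₂ → ∑ λ t₃ →
    if does (t₁ + ρ * t₂ + σ * t₃ ≟ 0#)
    then χ (ψ t₁ + ψ t₂ + ψ t₃) else 0ℤ
    where σ = 1# + ρ

{-# OPTIONS --safe #-}
module Submission where

-- Write ℘ b = b² + b, whose range is the kernel of the trace (Hilbert 90).  In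
-- characteristic 2 one has δ b = MCM (℘ b), so Δ is the image under the permutation
-- MCM of the kernel of the trace; its indicator function at MCM y is (1 + χ y) / 2,
-- whence 2 S μ = ∑ χ (μ x) + W MCM μ 1.  Character orthogonality turns
-- ∑ ŵ(μ a) ŵ(μ b) ŵ(μ c) into 2ⁿ times the weighted count of solutions of
-- a x + b y + c z = 0: for w = χ ∘ ψ this is 2ⁿ A ρ, for the indicator of Δ it is
-- 2ⁿ N.  Comparing both, with the term S(0)³ separated, 8 N v₁ v₂ = 2²ⁿ + A (v₂ / v₁).

open import Algebra.Bundles using (AbelianGroup; CommutativeMonoid; CommutativeRing; RawRing)
import Algebra.Properties.CommutativeMonoid.Sum as MonoidSum
import Algebra.Properties.CommutativeSemiring.Exp as CommutativeExp
import Algebra.Properties.Group as GroupProperties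
import Algebra.Properties.Semiring.Mult as Mult
import Algebra.Properties.Semiring.Sum as SemiringSum
import Algebra.Solver.Ring as RingSolver
open import Algebra.Solver.Ring.AlmostCommutativeRing
  using (AlmostCommutativeRing; fromCommutativeSemiring; _-Raw-AlmostCommutative⟶_)
import Algebra.Solver.Ring.NaturalCoefficients.Default as NatCoefficients
open import Data.Bool.Base using (Bool; true; false; _∧_; if_then_else_)
import Data.Bool.Properties as Bool
open import Data.Fin.Base using (Fin; zero; suc; inject≤; toℕ)
open import Data.Fin.Properties using (any?; inject≤-injective; suc-injective; 0≢1+n)
open import Data.Integer.Base using (1ℤ; -1ℤ)
import Data.Integer.Properties as ℤₚ
import Data.Integer.Solver as ℤSolver
open import Data.Maybe.Base using (Maybe; just; nothing)
import Data.Nat.Properties as ℕₚ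
open import Data.Product.Base using (∃; _,_; proj₁; proj₂)
import Data.Rational.Properties as ℚₚ
import Data.Rational.Unnormalised.Base as ℚᵘ
open import Function.Base using (_∘_)
open import Function.Bundles using (Inverse; mk⇔)
import Function.Construct.Composition as Composition
import Function.Construct.Symmetry as Symmetry
open import Level using (_⊔_)
open import Relation.Binary.Core using (_Preserves_⟶_)
import Relation.Binary.PropositionalEquality as ≡
import Relation.Binary.Reasoning.Setoid as SetoidReasoning
open import Relation.Nullary using (Dec; ¬_; yes; no; does; _×-dec_; contradiction)
open import Relation.Nullary.Decidable using (¬?; dec-true; dec-false; does-⇔; decidable-stable)

open import Defs
open import Data.Integer as ℤ using (ℤ; +_; 0ℤ)
open import Data.Nat as ℕ using (ℕ; _≤_; _∸_; _%_)
open import Data.Nat.GCD using (gcd)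
open import Data.Nat.Properties using (m^n≢0)
open import Data.Product using (_×_)
open import Data.Rational as ℚ using (ℚ)
open import Function.Bundles using (_⇔_)
open import Function.Definitions using (Inverseᵇ)
open import Relation.Binary.PropositionalEquality using (_≡_)

-- Of the field only the cardinality 2ⁿ is given, so its characteristic, the law `x ^ 2ⁿ ≈ x` and an
-- element of trace 1 all come from counting: translations and scalings permute the elements, which
-- yields the first two, and a polynomial of degree 2ⁿ⁻¹ cannot vanish everywhere, which yields the
-- third. The factorisation of δ through ℘ rests on telescoping. `T k (℘ b)` collapses to b^q + b,
-- so its power q + 1 is (b^(q²) + b^q)(b^q + b), while for b ≠ 0 the exponent q² - q + 1 makes F b
-- the quotient b^(q²) b / b^q. The relation W = 2 S breaks at μ = 0, where W is ∑ χ = 0 but 2 S is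
-- 2ⁿ. This one frequency produces the expected count: S(0)³ / 2ⁿ = (2ⁿ⁻¹)³ / 2ⁿ = 2²ⁿ⁻³, and A
-- measures the deviation from it.

module _ {a p} {A : Set a} {P : Set p} {u v : A} where
  if-yes : (P? : Dec P) → P → (if does P? then u else v) ≡ u
  if-yes P? p = ≡.cong (if_then u else v) (dec-true P? p)

  if-no : (P? : Dec P) → ¬ P → (if does P? then u else v) ≡ v
  if-no P? ¬p = ≡.cong (if_then u else v) (dec-false P? ¬p)

if-* : ∀ b z → (if b then z else 0ℤ) ≡ (if b then 1ℤ else 0ℤ) ℤ.* z
if-* true  z = ≡.sym (ℤₚ.*-identityˡ z)
if-* false z = ≡.refl

-- Brings the fourfold test in `N` into the shape of `∑-transform³`: the linear equation selects,
-- and the three memberships become a product of weights.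
if-∧ : ∀ a b c d → + (if a ∧ b ∧ c ∧ d then 1 else 0) ≡
       (if d then (if a then 1ℤ else 0ℤ) ℤ.* (if b then 1ℤ else 0ℤ) ℤ.* (if c then 1ℤ else 0ℤ) else 0ℤ)
if-∧ false _     _     false = ≡.refl
if-∧ false _     _     true  = ≡.refl
if-∧ true  false _     false = ≡.refl
if-∧ true  false _     true  = ≡.refl
if-∧ true  true  false false = ≡.refl
if-∧ true  true  false true  = ≡.refl
if-∧ true  true  true  false = ≡.refl
if-∧ true  true  true  true  = ≡.refl

-- Finite fields

module FieldProperties {c ℓ N} (𝔽 : FiniteField c ℓ N) where
  open FiniteField 𝔽 hiding (zero)
  open CommutativeExp commutativeSemiring
  open GroupProperties +-group using (∙-cancelʳ)
  open NatCoefficients commutativeSemiring using (solve; _:=_; _:+_; _:*_; con)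
  open SetoidReasoning setoid

  *-cancelˡ-≉0 : ∀ {x y z} → x ≉ 0# → x * y ≈ x * z → y ≈ z
  *-cancelˡ-≉0 {x} {y} {z} x≉0 xy≈xz = begin
    y              ≈⟨ undo y ⟨
    x′ * (x * y)   ≈⟨ *-congˡ xy≈xz ⟩
    x′ * (x * z)   ≈⟨ undo z ⟩
    z              ∎
    where
    x′ = proj₁ (invertible x≉0)
    undo : ∀ w → x′ * (x * w) ≈ w
    undo w = trans (sym (*-assoc _ _ _))
      (trans (*-congʳ (proj₁ (proj₂ (invertible x≉0)))) (*-identityˡ w))

  *-≉0 : ∀ {x y} → x ≉ 0# → y ≉ 0# → x * y ≉ 0#
  *-≉0 x≉0 y≉0 xy≈0 = y≉0 (*-cancelˡ-≉0 x≉0 (trans xy≈0 (sym (zeroʳ _))))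

  ^-≈0 : ∀ {x m} → 0 ℕ.< m → x ≈ 0# → x ^ m ≈ 0#
  ^-≈0 (ℕ.s≤s _) x≈0 = trans (*-congʳ x≈0) (zeroˡ _)

  ⁻¹-≈0 : ∀ {x} → x ≈ 0# → x ⁻¹ ≈ 0#
  ⁻¹-≈0 {x} x≈0 with x ≟ 0#
  ... | yes _  = refl
  ... | no x≉0 = contradiction x≈0 x≉0

  *-inverseʳ : ∀ {x} → x ≉ 0# → x * x ⁻¹ ≈ 1#
  *-inverseʳ {x} x≉0 with x ≟ 0#
  ... | yes x≈0 = contradiction x≈0 x≉0
  ... | no x≉0′ = proj₂ (proj₂ (invertible x≉0′))

  ^-≉0 : ∀ {x} m → x ≉ 0# → x ^ m ≉ 0#
  ^-≉0 ℕ.zero    x≉0 = 0≉1 ∘ sym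
  ^-≉0 (ℕ.suc m) x≉0 = *-≉0 x≉0 (^-≉0 m x≉0)

  translation : Carrier → Carrier → Inverse setoid setoid
  translation a b = record
    { to = _+ a ; from = _+ - a
    ; to-cong = +-congʳ ; from-cong = +-congʳ
    ; inverse = (λ {x} e → trans (+-congʳ e) (cancel x (-‿inverseˡ a)))
              , (λ {x} e → trans (+-congʳ e) (cancel x (-‿inverseʳ a)))
    }
    where
    cancel : ∀ x {u v} → u + v ≈ 0# → x + u + v ≈ x
    cancel x e = trans (+-assoc _ _ _) (trans (+-congˡ e) (+-identityʳ x))

  scaling : ∀ {a} → a ≉ 0# → Inverse setoid setoid
  scaling {a} a≉0 = record
    { to = a *_ ; from = a′ *_
    ; to-cong = *-congˡ ; from-cong = *-congˡ
    ; inverse = (λ {x} e → trans (*-congˡ e) (cancel x (proj₂ (proj₂ (invertible a≉0)))))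
              , (λ {x} e → trans (*-congˡ e) (cancel x (proj₁ (proj₂ (invertible a≉0)))))
    }
    where
    a′ = proj₁ (invertible a≉0)
    cancel : ∀ x {u v} → u * v ≈ 1# → u * (v * x) ≈ x
    cancel x e = trans (sym (*-assoc _ _ _)) (trans (*-congʳ e) (*-identityˡ x))

  module _ {m r} (M : CommutativeMonoid m r) where
    private module M = CommutativeMonoid M
    open MonoidSum M

    -- Conjugating β by the enumeration gives a permutation of the indices; f has to respect `_≈_`
    -- because `element (index x)` is only equivalent to x. The monoid is arbitrary since products
    -- in the field, sums in the field and integer sums are all reindexed.
    ∑-reindex : (β : Inverse setoid setoid) {f : Carrier → M.Carrier} →
                f Preserves _≈_ ⟶ M._≈_ →
                sum (f ∘ element) M.≈ sum (f ∘ Inverse.to β ∘ element)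
    ∑-reindex β f-cong = M.trans
      (sum-permute _ (Composition.inverse (Composition.inverse enumeration β)
                                          (Symmetry.inverse enumeration)))
      (sum-cong-≋ {N} λ i → f-cong (element-index (Inverse.to β (element i))))

    sum-single : ∀ {n} (i : Fin n) {t : Fin n → M.Carrier} →
                 (∀ j → ¬ (j ≡ i) → t j M.≈ M.ε) → sum t M.≈ t i
    sum-single {ℕ.suc n} zero off = M.trans
      (M.∙-congˡ (M.trans (sum-cong-≋ λ j → off (suc j) λ ()) (sum-replicate-zero n)))
      (M.identityʳ _)
    sum-single {ℕ.suc n} (suc i) off = M.trans
      (M.∙-cong (off zero λ ())
                (sum-single i λ j j≢i → off (suc j) (j≢i ∘ suc-injective)))
      (M.identityˡ _)

    ∑-single : ∀ a {f : Carrier → M.Carrier} → f Preserves _≈_ ⟶ M._≈_ →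
               (∀ x → x ≉ a → f x M.≈ M.ε) → sum (f ∘ element) M.≈ f a
    ∑-single a f-cong off = M.trans
      (sum-single (index a) λ j j≢ → off _ λ e →
         j≢ (≡.trans (≡.sym (Inverse.strictlyInverseʳ enumeration j))
                     (Inverse.from-cong enumeration e)))
      (f-cong (element-index a))

  private
    module ∏ = MonoidSum *-commutativeMonoid
    module ∑ᶠ = MonoidSum +-commutativeMonoid

  ∏-≉0 : ∀ {n} {t : Fin n → Carrier} → (∀ i → t i ≉ 0#) → ∏.sum t ≉ 0#
  ∏-≉0 {ℕ.zero}  _    = 0≉1 ∘ sym
  ∏-≉0 {ℕ.suc n} t≉0 = *-≉0 (t≉0 zero) (∏-≉0 (t≉0 ∘ suc))

  private
    orElse : Carrier → Carrier → Carrier → Carrier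
    orElse u v x = if does (x ≟ 0#) then u else v

    orElse-0 : ∀ {u v x} → x ≈ 0# → orElse u v x ≈ u
    orElse-0 {x = x} x≈0 = reflexive (if-yes (x ≟ 0#) x≈0)

    orElse-≉0 : ∀ {u v x} → x ≉ 0# → orElse u v x ≈ v
    orElse-≉0 {x = x} x≉0 = reflexive (if-no (x ≟ 0#) x≉0)

    orElse-cong : ∀ {u v v′ x x′} → v ≈ v′ → x ≈ x′ → orElse u v x ≈ orElse u v′ x′
    orElse-cong {x = x} v≈v′ x≈x′ with x ≟ 0#
    ... | yes x≈0 = trans (orElse-0 x≈0) (sym (orElse-0 (trans (sym x≈x′) x≈0)))
    ... | no  x≉0 = trans (orElse-≉0 x≉0) (trans v≈v′ (sym (orElse-≉0 (x≉0 ∘ trans x≈x′))))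

  -- Multiplying all nonzero elements by x permutes them.
  fermat : ∀ x → 0 ℕ.< N → x ^ N ≈ x
  fermat x 0<N with x ≟ 0#
  fermat x (ℕ.s≤s _) | yes x≈0 = trans (*-congʳ x≈0) (trans (zeroˡ _) (sym x≈0))
  ... | no x≉0 = *-cancelˡ-≉0 P≉0 (begin
    P * x ^ N                        ≈⟨ *-comm _ _ ⟩
    x ^ N * P                        ≈⟨ *-congʳ (∏.sum-replicate N) ⟨
    ∏.sum {N} (λ _ → x) * P          ≈⟨ ∏.∑-distrib-+ (λ _ → x) (g ∘ element) ⟨
    ∏.sum (λ i → x * g (element i))  ≈⟨ ∏.sum-cong-≋ (λ i → step (element i)) ⟩
    ∏.sum (λ i → g (x * element i) * d (element i))
                                     ≈⟨ ∏.∑-distrib-+ _ (d ∘ element) ⟩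
    ∏.sum (λ i → g (x * element i)) * ∏.sum (d ∘ element)
      ≈⟨ *-cong (sym (∑-reindex *-commutativeMonoid (scaling x≉0) g-cong))
                (∑-single *-commutativeMonoid 0# (orElse-cong refl)
                          λ y y≉0 → orElse-≉0 y≉0) ⟩
    P * d 0#                         ≈⟨ *-congˡ (orElse-0 refl) ⟩
    P * x                            ∎)
    where
    g d : Carrier → Carrier
    -- With 1 in place of the factor 0, P is the product of the nonzero elements. Among the N
    -- factors `x * g y` the one at y = 0 is a surplus x, which d collects; hence x^N = x and not
    -- x^(N-1) = 1.
    g y = orElse 1# y y
    d = orElse x 1#
    P = ∏.sum (g ∘ element)
    g-cong : ∀ {y z} → y ≈ z → g y ≈ g z
    g-cong e = orElse-cong e e
    P≉0 : P ≉ 0#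
    P≉0 = ∏-≉0 λ i e → g≉0 (element i) e
      where
      g≉0 : ∀ y → g y ≉ 0#
      g≉0 y with y ≟ 0#
      ... | yes y≈0 = 0≉1 ∘ sym ∘ trans (sym (orElse-0 y≈0))
      ... | no  y≉0 = y≉0 ∘ trans (sym (orElse-≉0 y≉0))
    step : ∀ y → x * g y ≈ g (x * y) * d y
    step y with y ≟ 0#
    ... | yes y≈0 = begin
      x * g y          ≈⟨ *-comm _ _ ⟩
      g y * x          ≈⟨ *-cong (g-cong (trans y≈0 (sym (trans (*-congˡ y≈0) (zeroʳ x)))))
                                 (sym (orElse-0 y≈0)) ⟩
      g (x * y) * d y  ∎
    ... | no  y≉0 = begin
      x * g y          ≈⟨ *-congˡ (orElse-≉0 y≉0) ⟩
      x * y            ≈⟨ orElse-≉0 (*-≉0 x≉0 y≉0) ⟨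
      g (x * y)        ≈⟨ *-identityʳ _ ⟨
      g (x * y) * 1#   ≈⟨ *-congˡ (orElse-≉0 y≉0) ⟨
      g (x * y) * d y  ∎

  open Mult semiring using () renaming (_×_ to _×′_)

  -- Translation by 1 permutes the field, so adding 1 to each of the N summands leaves the sum of
  -- all elements unchanged.
  order×1≈0 : N ×′ 1# ≈ 0#
  order×1≈0 = ∙-cancelʳ Σx _ _ (begin
    N ×′ 1# + Σx                  ≈⟨ +-congʳ (∑ᶠ.sum-replicate N) ⟨
    ∑ᶠ.sum {N} (λ _ → 1#) + Σx    ≈⟨ +-comm _ _ ⟩
    Σx + ∑ᶠ.sum {N} (λ _ → 1#)    ≈⟨ ∑ᶠ.∑-distrib-+ element (λ _ → 1#) ⟨
    ∑ᶠ.sum (λ i → element i + 1#) ≈⟨ ∑-reindex +-commutativeMonoid (translation 1# 1#) {λ x → x} (λ e → e) ⟨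
    Σx                            ≈⟨ +-identityˡ _ ⟨
    0# + Σx                       ∎)
    where Σx = ∑ᶠ.sum element

  -- A Horner scheme to which f is tied only pointwise, so that functions such as `T m` can be
  -- certified directly. The index is the exact degree, which the root bound needs.
  data Monic : ℕ → (Carrier → Carrier) → Set (c ⊔ ℓ) where
    one : ∀ {f} → (∀ x → f x ≈ 1#) → Monic 0 f
    horner : ∀ {d f} a {g} → Monic d g → (∀ x → f x ≈ a + x * g x) → Monic (ℕ.suc d) f

  -- The usual quotient of f by x − r, with the subtracted terms moved across.
  monic-divide : ∀ {d f} → Monic (ℕ.suc d) f → ∀ r →
                 ∃ λ h → Monic d h × (∀ x → f x + r * h x ≈ f r + x * h x)
  monic-divide {f = f} (horner a {g} (one g≈1) f≈) r = (λ _ → 1#) , one (λ _ → refl) , λ x → begin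
    f x + r * 1#         ≈⟨ +-congʳ (trans (f≈ x) (+-congˡ (*-congˡ (g≈1 x)))) ⟩
    a + x * 1# + r * 1#  ≈⟨ solve 3 (λ a x r → a :+ x :* con 1 :+ r :* con 1 :=
                              a :+ r :* con 1 :+ x :* con 1) refl a x r ⟩
    a + r * 1# + x * 1#  ≈⟨ +-congʳ (trans (f≈ r) (+-congˡ (*-congˡ (g≈1 r)))) ⟨
    f r + x * 1#         ∎
  monic-divide {f = f} (horner a {g} g-monic@(horner _ _ _) f≈) r
    with monic-divide g-monic r
  ... | h , h-monic , g≈ = h′ , horner (g r) h-monic (λ _ → refl) , λ x → begin
    f x + r * h′ x                         ≈⟨ +-congʳ (f≈ x) ⟩
    a + x * g x + r * (g r + x * h x)      ≈⟨ solve 6 (λ a x r u v w →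
      a :+ x :* u :+ r :* (v :+ x :* w) := a :+ r :* v :+ x :* (u :+ r :* w))
      refl a x r (g x) (g r) (h x) ⟩
    a + r * g r + x * (g x + r * h x)      ≈⟨ +-cong (sym (f≈ r)) (*-congˡ (g≈ x)) ⟩
    f r + x * h′ x                         ∎
    where
    h′ : Carrier → Carrier
    h′ x = g r + x * h x

  -- Induction on the degree: divide by the first root r₀. At another root s the division identity
  -- reads r₀ h(s) = s h(s), so h(s) ≠ 0 would force r₀ = s.
  monic-roots : ∀ {d f} → Monic d f → (r : Fin (ℕ.suc d) → Carrier) →
                (∀ {i j} → r i ≈ r j → i ≡ j) → ¬ (∀ i → f (r i) ≈ 0#)
  monic-roots (one f≈1) r r-inj roots = 0≉1 (trans (sym (roots zero)) (f≈1 _))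
  monic-roots {ℕ.suc d} {f} f-monic r r-inj roots with monic-divide f-monic (r zero)
  ... | h , h-monic , f≈ = monic-roots h-monic (r ∘ suc) (suc-injective ∘ r-inj) h-roots
    where
    h-roots : ∀ i → h (r (suc i)) ≈ 0#
    h-roots i = decidable-stable (_ ≟ 0#) λ h≉0 →
      0≢1+n (r-inj (*-cancelˡ-≉0 h≉0 (begin
        h s * r zero          ≈⟨ *-comm _ _ ⟩
        r zero * h s          ≈⟨ +-identityˡ _ ⟨
        0# + r zero * h s     ≈⟨ +-congʳ (roots (suc i)) ⟨
        f s + r zero * h s    ≈⟨ f≈ s ⟩
        f (r zero) + s * h s  ≈⟨ +-congʳ (roots zero) ⟩
        0# + s * h s          ≈⟨ +-identityˡ _ ⟩
        s * h s               ≈⟨ *-comm _ _ ⟩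
        h s * s               ∎)))
      where s = r (suc i)

  monic-square : ∀ {d f} → Monic d f → Monic (d ℕ.* 2) (λ x → f (x * x))
  monic-square (one f≈1) = one (λ x → f≈1 (x * x))
  monic-square (horner a {g} g-monic f≈) =
    horner a (horner 0# (monic-square g-monic) (λ _ → refl)) λ x → trans (f≈ (x * x))
      (+-congˡ (trans (*-assoc x x _) (*-congˡ (sym (+-identityˡ _)))))

  monic-cong : ∀ {d f g} → (∀ x → f x ≈ g x) → Monic d g → Monic d f
  monic-cong f≈g (one g≈1)           = one λ x → trans (f≈g x) (g≈1 x)
  monic-cong f≈g (horner a h-monic g≈) = horner a h-monic λ x → trans (f≈g x) (g≈ x)

  -- Mirrors the recursion `T-suc`. The odd coefficients of f(x²) vanish, so there is room for the
  -- new term x; in degree 0 that term would become the leading one, whence `0 < d`.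
  monic-x+square : ∀ {d f} → 0 ℕ.< d → Monic d f → Monic (d ℕ.* 2) (λ x → x + f (x * x))
  monic-x+square {f = f} _ (horner a {g} g-monic f≈) =
    horner a (horner 1# (monic-square g-monic) (λ _ → refl)) λ x → begin
      x + f (x * x)                  ≈⟨ +-congˡ (f≈ (x * x)) ⟩
      x + (a + x * x * g (x * x))    ≈⟨ solve 3 (λ a x u →
        x :+ (a :+ x :* x :* u) := a :+ x :* (con 1 :+ x :* u)) refl a x (g (x * x)) ⟩
      a + x * (1# + x * g (x * x))   ∎

  -- Integer sums over the field

  private module ∑ℤ = SemiringSum ℤₚ.+-*-semiring

  ∑-cong : ∀ {f g} → (∀ x → f x ≡ g x) → ∑ f ≡ ∑ g
  ∑-cong f≗g = ∑ℤ.sum-cong-≗ {N} (f≗g ∘ element)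

  ∑-+ : ∀ f g → ∑ (λ x → f x ℤ.+ g x) ≡ ∑ f ℤ.+ ∑ g
  ∑-+ f g = ∑ℤ.∑-distrib-+ {N} (f ∘ element) (g ∘ element)

  ∑-*ˡ : ∀ z f → z ℤ.* ∑ f ≡ ∑ (λ x → z ℤ.* f x)
  ∑-*ˡ z f = ∑ℤ.*-distribˡ-sum {N} z (f ∘ element)

  ∑-*ʳ : ∀ z f → ∑ f ℤ.* z ≡ ∑ (λ x → f x ℤ.* z)
  ∑-*ʳ z f = ∑ℤ.*-distribʳ-sum {N} z (f ∘ element)

  ∑-swap : ∀ (f : Carrier → Carrier → ℤ) → ∑ (λ x → ∑ (f x)) ≡ ∑ (λ y → ∑ (λ x → f x y))
  ∑-swap f = ∑ℤ.∑-comm {N} {N} λ i j → f (element i) (element j)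

  ∑-1 : ∑ (λ _ → 1ℤ) ≡ + N
  ∑-1 = count N
    where
    count : ∀ m → ∑ℤ.sum {m} (λ _ → 1ℤ) ≡ + m
    count ℕ.zero    = ≡.refl
    count (ℕ.suc m) = ≡.cong (ℤ._+_ 1ℤ) (count m)

  +∑ℕ : ∀ f → + ∑ℕ f ≡ ∑ (λ x → + f x)
  +∑ℕ f = cast (f ∘ element)
    where
    cast : ∀ {m} (t : Fin m → ℕ) →
           + MonoidSum.sum ℕₚ.+-0-commutativeMonoid t ≡ ∑ℤ.sum (λ i → + t i)
    cast {ℕ.zero}  t = ≡.refl
    cast {ℕ.suc m} t = ≡.cong (ℤ._+_ (+ t zero)) (cast (t ∘ suc))

  ∑³ : (Carrier → Carrier → Carrier → ℤ) → ℤ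
  ∑³ f = ∑ λ x → ∑ λ y → ∑ λ z → f x y z

  ∑³-cong : ∀ {f g} → (∀ x y z → f x y z ≡ g x y z) → ∑³ f ≡ ∑³ g
  ∑³-cong f≗g = ∑-cong λ x → ∑-cong λ y → ∑-cong (f≗g x y)

  ∑³-*ˡ : ∀ a f → a ℤ.* ∑³ f ≡ ∑³ (λ x y z → a ℤ.* f x y z)
  ∑³-*ˡ a f = ≡.trans (∑-*ˡ a λ x → ∑ λ y → ∑ λ z → f x y z) (∑-cong λ x →
    ≡.trans (∑-*ˡ a λ y → ∑ λ z → f x y z) (∑-cong λ y → ∑-*ˡ a (f x y)))

  ∑-product³ : ∀ f g h → ∑ f ℤ.* ∑ g ℤ.* ∑ h ≡ ∑³ (λ x y z → f x ℤ.* g y ℤ.* h z)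
  ∑-product³ f g h = ≡.trans
    (≡.cong (ℤ._* ∑ h) (≡.trans (∑-*ʳ (∑ g) f) (∑-cong λ x → ∑-*ˡ (f x) g)))
    (≡.trans (∑-*ʳ (∑ h) λ x → ∑ λ y → f x ℤ.* g y) (∑-cong λ x →
      ≡.trans (∑-*ʳ (∑ h) λ y → f x ℤ.* g y) (∑-cong λ y → ∑-*ˡ (f x ℤ.* g y) h)))

  ∑-swap³ : ∀ (f : Carrier → Carrier → Carrier → Carrier → ℤ) →
            ∑ (λ w → ∑³ (f w)) ≡ ∑³ (λ x y z → ∑ (λ w → f w x y z))
  ∑-swap³ f = ≡.trans (∑-swap λ w x → ∑ λ y → ∑ λ z → f w x y z) (∑-cong λ x →
    ≡.trans (∑-swap λ w y → ∑ λ z → f w x y z) (∑-cong λ y → ∑-swap λ w z → f w x y z))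

-- The trace and the MCM polynomial

module KasamiProperties {c ℓ} (n k : ℕ) (0<n : 0 ℕ.< n) (𝔽 : FiniteField c ℓ (2 ℕ.^ n)) where
  open FiniteField 𝔽 hiding (zero)
  open FieldProperties 𝔽
  open Kasami n k 𝔽
  open CommutativeExp commutativeSemiring
  open Mult semiring using (×1-homo-*) renaming (_×_ to _×′_)
  open MonoidSum +-commutativeMonoid using (sum; sum-cong-≋; ∑-distrib-+)
  open SetoidReasoning setoid

  -- The order 2ⁿ annihilates 1, and 2ⁿ times 1 is the n-th power of 1 + 1; a field has no nonzero
  -- nilpotents.
  1+1≈0 : 1# + 1# ≈ 0#
  1+1≈0 = decidable-stable (_ ≟ 0#) λ 1+1≉0 →
    ^-≉0 n 1+1≉0 (trans (sym (order n)) order×1≈0)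
    where
    order : ∀ m → (2 ℕ.^ m) ×′ 1# ≈ (1# + 1#) ^ m
    order ℕ.zero    = +-identityʳ 1#
    order (ℕ.suc m) = trans (×1-homo-* 2 (2 ℕ.^ m))
      (*-cong (+-congˡ (+-identityʳ 1#)) (order m))

  private
    almostCommutativeRing : AlmostCommutativeRing c ℓ
    almostCommutativeRing = fromCommutativeSemiring commutativeSemiring

    𝔽₂ : RawRing _ _
    𝔽₂ = CommutativeRing.rawRing Bool.xor-∧-commutativeRing

    𝔽₂-embedding : 𝔽₂ -Raw-AlmostCommutative⟶ almostCommutativeRing
    𝔽₂-embedding = record
      { ⟦_⟧    = λ b → if b then 1# else 0#
      ; +-homo = λ where
          true  true  → sym 1+1≈0
          true  false → sym (+-identityʳ 1#)
          false _     → sym (+-identityˡ _)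
      ; *-homo = λ where
          true  _ → sym (*-identityˡ _)
          false _ → sym (zeroˡ _)
      ; -‿homo = λ _ → refl
      ; 0-homo = refl
      ; 1-homo = refl
      }

    _𝔽₂≟_ : (a b : Bool) →
            Maybe ((if a then 1# else 0#) ≈ (if b then 1# else 0#))
    true  𝔽₂≟ true  = just refl
    false 𝔽₂≟ false = just refl
    _     𝔽₂≟ _     = nothing

  -- Coefficients in 𝔽₂ make the solver normalise modulo 2.
  open RingSolver 𝔽₂ almostCommutativeRing 𝔽₂-embedding _𝔽₂≟_ public
    using (solve; _:=_; _:+_; _:*_; con)

  x+x≈0 : ∀ x → x + x ≈ 0#
  x+x≈0 = solve 1 (λ x → x :+ x := con false) refl

  +≈0⇒≈ : ∀ {x y} → x + y ≈ 0# → x ≈ y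
  +≈0⇒≈ {x} {y} x+y≈0 = begin
    x            ≈⟨ solve 2 (λ x y → x := x :+ y :+ y) refl x y ⟩
    x + y + y    ≈⟨ +-congʳ x+y≈0 ⟩
    0# + y       ≈⟨ +-identityˡ y ⟩
    y            ∎

  ^-2^suc : ∀ x m → x ^ (2 ℕ.^ ℕ.suc m) ≈ (x * x) ^ (2 ℕ.^ m)
  ^-2^suc x m = begin
    x ^ (2 ℕ.* 2 ℕ.^ m)         ≈⟨ ^-assocʳ x 2 (2 ℕ.^ m) ⟨
    (x * (x * 1#)) ^ (2 ℕ.^ m)  ≈⟨ ^-congˡ (2 ℕ.^ m) (*-congˡ (*-identityʳ x)) ⟩
    (x * x) ^ (2 ℕ.^ m)         ∎

  frobenius : ∀ m x y → (x + y) ^ (2 ℕ.^ m) ≈ x ^ (2 ℕ.^ m) + y ^ (2 ℕ.^ m)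
  frobenius ℕ.zero    x y = trans (*-identityʳ _) (sym (+-cong (*-identityʳ x) (*-identityʳ y)))
  frobenius (ℕ.suc m) x y = begin
    (x + y) ^ (2 ℕ.^ ℕ.suc m)                         ≈⟨ ^-2^suc (x + y) m ⟩
    ((x + y) * (x + y)) ^ (2 ℕ.^ m)                   ≈⟨ ^-congˡ (2 ℕ.^ m) (solve 2
      (λ x y → (x :+ y) :* (x :+ y) := x :* x :+ y :* y) refl x y) ⟩
    (x * x + y * y) ^ (2 ℕ.^ m)                       ≈⟨ frobenius m _ _ ⟩
    (x * x) ^ (2 ℕ.^ m) + (y * y) ^ (2 ℕ.^ m)         ≈⟨ +-cong (^-2^suc x m) (^-2^suc y m) ⟨
    x ^ (2 ℕ.^ ℕ.suc m) + y ^ (2 ℕ.^ ℕ.suc m)         ∎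

  1^≈1 : ∀ m → 1# ^ m ≈ 1#
  1^≈1 ℕ.zero    = refl
  1^≈1 (ℕ.suc m) = trans (*-identityˡ _) (1^≈1 m)

  -- Partial traces and the absolute trace

  T-cong : ∀ m {x y} → x ≈ y → T m x ≈ T m y
  T-cong m x≈y = sum-cong-≋ {m} λ i → ^-congˡ (2 ℕ.^ toℕ i) x≈y

  T-+ : ∀ m x y → T m (x + y) ≈ T m x + T m y
  T-+ m x y = trans (sum-cong-≋ {m} λ i → frobenius (toℕ i) x y)
    (∑-distrib-+ {m} (λ i → x ^ (2 ℕ.^ toℕ i)) (λ i → y ^ (2 ℕ.^ toℕ i)))

  T-suc : ∀ m x → T (ℕ.suc m) x ≈ x + T m (x * x)
  T-suc m x = +-cong (*-identityʳ x) (sum-cong-≋ {m} λ i → ^-2^suc x (toℕ i))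

  T-square : ∀ m x → T m (x * x) ≈ T m x * T m x
  T-square ℕ.zero    x = sym (zeroˡ _)
  T-square (ℕ.suc m) x = begin
    T (ℕ.suc m) (x * x)                     ≈⟨ T-suc m (x * x) ⟩
    x * x + T m ((x * x) * (x * x))         ≈⟨ +-congˡ (T-square m (x * x)) ⟩
    x * x + T m (x * x) * T m (x * x)       ≈⟨ solve 2
      (λ x y → x :* x :+ y :* y := (x :+ y) :* (x :+ y)) refl x (T m (x * x)) ⟩
    (x + T m (x * x)) * (x + T m (x * x))   ≈⟨ *-cong (T-suc m x) (T-suc m x) ⟨
    T (ℕ.suc m) x * T (ℕ.suc m) x           ∎

  T-suc-square : ∀ m x → T (ℕ.suc m) x ≈ x + T m x * T m x
  T-suc-square m x = trans (T-suc m x) (+-congˡ (T-square m x))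

  -- The sum unfolds at its lowest term, so splitting off the highest takes an induction. Comparing
  -- the two splittings is what gives both `T-℘` and `Tr-idem`.
  T-last : ∀ m x → T (ℕ.suc m) x ≈ T m x + x ^ (2 ℕ.^ m)
  T-last ℕ.zero    x = +-comm _ _
  T-last (ℕ.suc m) x = begin
    T (ℕ.suc (ℕ.suc m)) x                     ≈⟨ T-suc (ℕ.suc m) x ⟩
    x + T (ℕ.suc m) (x * x)                   ≈⟨ +-congˡ (T-last m (x * x)) ⟩
    x + (T m (x * x) + (x * x) ^ (2 ℕ.^ m))   ≈⟨ +-assoc _ _ _ ⟨
    x + T m (x * x) + (x * x) ^ (2 ℕ.^ m)     ≈⟨ +-cong (T-suc m x) (^-2^suc x m) ⟨
    T (ℕ.suc m) x + x ^ (2 ℕ.^ ℕ.suc m)       ∎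

  ℘ : Carrier → Carrier
  ℘ x = x * x + x

  -- The sum telescopes: T m (x²) and T m x share every power of x except the two extreme ones.
  T-℘ : ∀ m x → T m (℘ x) ≈ x ^ (2 ℕ.^ m) + x
  T-℘ m x = begin
    T m (x * x + x)                             ≈⟨ T-+ m (x * x) x ⟩
    T m (x * x) + T m x                         ≈⟨ solve 3
      (λ a b c → a :+ b := c :+ a :+ b :+ c) refl (T m (x * x)) (T m x) x ⟩
    x + T m (x * x) + T m x + x                 ≈⟨ +-congʳ (+-congʳ (T-suc m x)) ⟨
    T (ℕ.suc m) x + T m x + x                   ≈⟨ +-congʳ (+-congʳ (T-last m x)) ⟩
    T m x + x ^ (2 ℕ.^ m) + T m x + x           ≈⟨ solve 3
      (λ a b c → a :+ b :+ a :+ c := b :+ c) refl (T m x) (x ^ (2 ℕ.^ m)) x ⟩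
    x ^ (2 ℕ.^ m) + x                           ∎

  x^2^n≈x : ∀ x → x ^ (2 ℕ.^ n) ≈ x
  x^2^n≈x x = fermat x (ℕₚ.m^n>0 2 n)

  Tr-℘ : ∀ x → Tr (℘ x) ≈ 0#
  Tr-℘ x = trans (T-℘ n x) (trans (+-congʳ (x^2^n≈x x)) (x+x≈0 x))

  -- T (n + 1) x is x + (Tr x)² when split at the bottom and Tr x + x when split at the top, because
  -- x^(2ⁿ) = x.
  Tr-idem : ∀ x → Tr x * Tr x ≈ Tr x
  Tr-idem x = begin
    Tr x * Tr x              ≈⟨ solve 2 (λ a x → a := x :+ a :+ x) refl (Tr x * Tr x) x ⟩
    x + Tr x * Tr x + x      ≈⟨ +-congʳ (T-suc-square n x) ⟨
    T (ℕ.suc n) x + x        ≈⟨ +-congʳ (T-last n x) ⟩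
    Tr x + x ^ (2 ℕ.^ n) + x ≈⟨ +-congʳ (+-congˡ (x^2^n≈x x)) ⟩
    Tr x + x + x             ≈⟨ solve 2 (λ a x → a :+ x :+ x := a) refl (Tr x) x ⟩
    Tr x                     ∎

  Tr≉0⇒Tr≈1 : ∀ {x} → Tr x ≉ 0# → Tr x ≈ 1#
  Tr≉0⇒Tr≈1 {x} Tr≉0 = *-cancelˡ-≉0 Tr≉0 (trans (Tr-idem x) (sym (*-identityʳ _)))

  T-monic : ∀ m → Monic (2 ℕ.^ m) (T (ℕ.suc m))
  T-monic ℕ.zero    = horner 0# (one λ _ → refl) λ x →
    trans (+-identityʳ _) (sym (+-identityˡ _))
  T-monic (ℕ.suc m) = ≡.subst (λ d → Monic d (T (ℕ.suc (ℕ.suc m)))) (ℕₚ.*-comm (2 ℕ.^ m) 2)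
    (monic-cong (T-suc (ℕ.suc m)) (monic-x+square (ℕₚ.m^n>0 2 m) (T-monic m)))

  -- The polynomial has degree 2^m, so it cannot vanish on the first 2^m + 1 elements of the
  -- enumeration; the strict inequality says that there are that many.
  T-nonzero : ∀ m → 2 ℕ.^ m ℕ.< 2 ℕ.^ n → ∃ λ i → T (ℕ.suc m) (element i) ≉ 0#
  T-nonzero m 2^m<2^n = decidable-stable (any? λ i → ¬? (T (ℕ.suc m) (element i) ≟ 0#))
    λ none → monic-roots (T-monic m) (λ i → element (inject≤ i 2^m<2^n))
      (λ e → inject≤-injective _ _ _ _ (≡.trans (≡.sym (index-element _))
               (≡.trans (Inverse.from-cong enumeration e) (index-element _))))
      λ i → decidable-stable (_ ≟ 0#) λ T≉0 → none (_ , T≉0)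
    where index-element = Inverse.strictlyInverseʳ enumeration

  Tr-surjective : ∃ λ x → Tr x ≈ 1#
  Tr-surjective with T-nonzero (ℕ.pred n)
    (ℕₚ.^-monoʳ-< 2 (ℕ.s≤s (ℕ.s≤s ℕ.z≤n))
      (ℕₚ.≤-reflexive (ℕₚ.suc-pred n {{ℕ.>-nonZero 0<n}})))
  ... | i , T≉0 = element i , Tr≉0⇒Tr≈1
    (≡.subst (λ m → T m (element i) ≉ 0#) (ℕₚ.suc-pred n {{ℕ.>-nonZero 0<n}}) T≉0)

  -- Additive Hilbert 90: if Tr x = 1, then b = ∑ T i y · x ^ 2ⁱ (i < n) solves ℘ b = y.
  hilbert90 : ∀ {y} → Tr y ≈ 0# → ∃ λ b → ℘ b ≈ y
  hilbert90 {y} Tr-y≈0 = b n , (begin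
    b n * b n + b n                                                 ≈⟨ +-congʳ (b-square n) ⟩
    b n + Tr y * x ^ (2 ℕ.^ n) + y * (Tr x * Tr x) + b n            ≈⟨ +-congʳ (+-cong
      (+-congˡ (*-congʳ Tr-y≈0)) (*-congˡ (*-cong Tr-x≈1 Tr-x≈1))) ⟩
    b n + 0# * x ^ (2 ℕ.^ n) + y * (1# * 1#) + b n                  ≈⟨ solve 3
      (λ b e y → b :+ con false :* e :+ y :* (con true :* con true) :+ b := y)
      refl (b n) (x ^ (2 ℕ.^ n)) y ⟩
    y                                                               ∎)
    where
    x = proj₁ Tr-surjective
    Tr-x≈1 = proj₂ Tr-surjective
    b : ℕ → Carrier
    b ℕ.zero    = 0#
    b (ℕ.suc m) = b m + T m y * x ^ (2 ℕ.^ m)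
    -- Squaring moves x^(2ⁱ) to the next power and turns T i y into T (i+1) y + y. The first part
    -- reproduces the sum for m + 1, and the second gives y (x² + ... + x^(2^m)) = y (T m x)². At m
    -- = n the boundary term dies with Tr y, and Tr x = 1 leaves exactly y.
    b-square : ∀ m → b m * b m ≈ b m + T m y * x ^ (2 ℕ.^ m) + y * (T m x * T m x)
    b-square ℕ.zero    = solve 2 (λ e y → con false :* con false :=
      con false :+ con false :* e :+ y :* (con false :* con false)) refl (x ^ 1) y
    b-square (ℕ.suc m) = begin
      (B + t * e) * (B + t * e)                       ≈⟨ solve 3
        (λ B t e → (B :+ t :* e) :* (B :+ t :* e) := B :* B :+ t :* t :* (e :* e)) refl B t e ⟩
      B * B + t * t * (e * e)                         ≈⟨ +-congʳ (b-square m) ⟩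
      B + t * e + y * (s * s) + t * t * (e * e)       ≈⟨ solve 6
        (λ B t e y s x → B :+ t :* e :+ y :* (s :* s) :+ t :* t :* (e :* e) :=
          B :+ t :* e :+ (y :+ t :* t) :* (e :* e) :+ y :* (s :* s :+ e :* e)) refl B t e y s x ⟩
      B + t * e + (y + t * t) * (e * e) + y * (s * s + e * e)
        ≈⟨ +-cong (+-congˡ (*-cong (sym (T-suc-square m y)) (sym e-square)))
                  (*-congˡ (trans (solve 2 (λ s e → s :* s :+ e :* e := (s :+ e) :* (s :+ e)) refl s e)
                                  (sym (*-cong (T-last m x) (T-last m x))))) ⟩
      B + t * e + T (ℕ.suc m) y * x ^ (2 ℕ.^ ℕ.suc m) + y * (T (ℕ.suc m) x * T (ℕ.suc m) x) ∎
      where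
      B = b m
      t = T m y
      s = T m x
      e = x ^ (2 ℕ.^ m)
      e-square : x ^ (2 ℕ.^ ℕ.suc m) ≈ e * e
      e-square = trans (^-2^suc x m) (^-distrib-* x x (2 ℕ.^ m))

  -- The factorisation of δ through ℘

  F-*-^q : ∀ b → F b * b ^ q ≈ (b ^ q) ^ q * b
  F-*-^q b = begin
    F b * b ^ q                            ≈⟨ ^-homo-* b (4 ℕ.^ k ∸ q ℕ.+ 1) q ⟨
    b ^ (4 ℕ.^ k ∸ q ℕ.+ 1 ℕ.+ q)          ≡⟨ ≡.cong (b ^_) exponents ⟩
    b ^ (q ℕ.* q ℕ.+ 1)                    ≈⟨ ^-homo-* b (q ℕ.* q) 1 ⟩
    b ^ (q ℕ.* q) * b ^ 1                  ≈⟨ *-cong (sym (^-assocʳ b q q)) (*-identityʳ b) ⟩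
    (b ^ q) ^ q * b                        ∎
    where
    4^k≡q*q : 4 ℕ.^ k ≡ q ℕ.* q
    4^k≡q*q = ≡.trans (ℕₚ.^-*-assoc 2 2 k) (≡.trans (≡.cong (2 ℕ.^_) (ℕₚ.*-comm 2 k))
      (≡.trans (≡.sym (ℕₚ.^-*-assoc 2 k 2)) (≡.cong (q ℕ.*_) (ℕₚ.*-identityʳ q))))
    -- As 2^k ≤ 4^k, the truncated subtraction is a true one, and the factor b^q cancels the
    -- negative part of q² - q + 1 without any division by b.
    exponents : 4 ℕ.^ k ∸ q ℕ.+ 1 ℕ.+ q ≡ q ℕ.* q ℕ.+ 1
    exponents = ≡.trans (ℕₚ.+-assoc (4 ℕ.^ k ∸ q) 1 q)
      (≡.trans (≡.cong (4 ℕ.^ k ∸ q ℕ.+_) (ℕₚ.+-comm 1 q))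
      (≡.trans (≡.sym (ℕₚ.+-assoc (4 ℕ.^ k ∸ q) q 1))
      (≡.cong (ℕ._+ 1) (≡.trans
        (ℕₚ.m∸n+n≡m (ℕₚ.^-monoˡ-≤ k (ℕ.s≤s (ℕ.s≤s (ℕ.z≤n {2}))))) 4^k≡q*q))))

  F-≈0 : ∀ {b} → b ≈ 0# → F b ≈ 0#
  F-≈0 = ^-≈0 (ℕₚ.m≤n+m 1 (4 ℕ.^ k ∸ q))

  F-≈1 : ∀ {b} → b ≈ 1# → F b ≈ 1#
  F-≈1 b≈1 = trans (^-congˡ (4 ℕ.^ k ∸ q ℕ.+ 1) b≈1) (1^≈1 (4 ℕ.^ k ∸ q ℕ.+ 1))

  -- The case where (℘ b)^q cannot be cancelled. The roots of ℘ are 0 and 1, which b ↦ b + 1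
  -- exchanges, so both give F 0 + F 1 + 1 = 0, the value that MCM takes at 0.
  ℘≈0⇒δ≈0 : ∀ {b} → ℘ b ≈ 0# → δ b ≈ 0#
  ℘≈0⇒δ≈0 {b} ℘b≈0 with b ≟ 0#
  ... | yes b≈0 = begin
    F b + F (b + 1#) + 1#  ≈⟨ +-congʳ (+-cong (F-≈0 b≈0) (F-≈1 (trans (+-congʳ b≈0) (+-identityˡ 1#)))) ⟩
    0# + 1# + 1#           ≈⟨ solve 0 (con false :+ con true :+ con true := con false) refl ⟩
    0#                     ∎
  ... | no  b≉0 = begin
    F b + F (b + 1#) + 1#  ≈⟨ +-congʳ (+-cong (F-≈1 (+≈0⇒≈ b+1≈0)) (F-≈0 b+1≈0)) ⟩
    1# + 0# + 1#           ≈⟨ solve 0 (con true :+ con false :+ con true := con false) refl ⟩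
    0#                     ∎
    where
    b+1≈0 : b + 1# ≈ 0#
    b+1≈0 = *-cancelˡ-≉0 b≉0 (begin
      b * (b + 1#)  ≈⟨ solve 1 (λ b → b :* (b :+ con true) := b :* b :+ b) refl b ⟩
      ℘ b           ≈⟨ ℘b≈0 ⟩
      0#            ≈⟨ zeroʳ b ⟨
      b * 0#        ∎)

  -- Clearing denominators, with Q = b^q and R = b^(q²), both sides equal (R + Q)(Q + b).
  δ-*-℘^q : ∀ b → δ b * ℘ b ^ q ≈ T k (℘ b) ^ (q ℕ.+ 1)
  δ-*-℘^q b = begin
    δ b * ℘ b ^ q
      ≈⟨ *-congˡ (trans (^-congˡ q (solve 1 (λ b → b :* b :+ b := b :* (b :+ con true)) refl b))
                        (trans (^-distrib-* b (b + 1#) q) (*-congˡ shift))) ⟩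
    (f + g + 1#) * (Q * (Q + 1#))
      ≈⟨ solve 3 (λ f g Q → (f :+ g :+ con true) :* (Q :* (Q :+ con true)) :=
           f :* Q :* (Q :+ con true) :+ g :* (Q :+ con true) :* Q :+ Q :* (Q :+ con true)) refl f g Q ⟩
    f * Q * (Q + 1#) + g * (Q + 1#) * Q + Q * (Q + 1#)
      ≈⟨ +-congʳ (+-cong (*-congʳ (F-*-^q b)) (*-congʳ g-*-Q+1)) ⟩
    R * b * (Q + 1#) + (R + 1#) * (b + 1#) * Q + Q * (Q + 1#)
      ≈⟨ solve 3 (λ b Q R → R :* b :* (Q :+ con true) :+ (R :+ con true) :* (b :+ con true) :* Q
           :+ Q :* (Q :+ con true) := (R :+ Q) :* (Q :+ b)) refl b Q R ⟩
    (R + Q) * (Q + b)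
      ≈⟨ *-cong (trans (^-congˡ q (T-℘ k b)) (frobenius k Q b)) (trans (*-identityʳ _) (T-℘ k b)) ⟨
    T k (℘ b) ^ q * T k (℘ b) ^ 1
      ≈⟨ ^-homo-* (T k (℘ b)) q 1 ⟨
    T k (℘ b) ^ (q ℕ.+ 1) ∎
    where
    f = F b
    g = F (b + 1#)
    Q = b ^ q
    R = Q ^ q
    shift : (b + 1#) ^ q ≈ Q + 1#
    shift = trans (frobenius k b 1#) (+-congˡ (1^≈1 q))
    g-*-Q+1 : g * (Q + 1#) ≈ (R + 1#) * (b + 1#)
    g-*-Q+1 = begin
      g * (Q + 1#)                   ≈⟨ *-congˡ shift ⟨
      g * (b + 1#) ^ q               ≈⟨ F-*-^q (b + 1#) ⟩
      ((b + 1#) ^ q) ^ q * (b + 1#)  ≈⟨ *-congʳ (trans (^-congˡ q shift)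
                                          (trans (frobenius k Q 1#) (+-congˡ (1^≈1 q)))) ⟩
      (R + 1#) * (b + 1#)            ∎

  δ≈MCM∘℘ : ∀ b → δ b ≈ MCM (℘ b)
  δ≈MCM∘℘ b with ℘ b ≟ 0#
  ... | yes ℘b≈0 = begin
    δ b                         ≈⟨ ℘≈0⇒δ≈0 ℘b≈0 ⟩
    0#                          ≈⟨ zeroʳ _ ⟨
    T k (℘ b) ^ (q ℕ.+ 1) * 0#  ≈⟨ *-congˡ (⁻¹-≈0 (^-≈0 (ℕₚ.m^n>0 2 k) ℘b≈0)) ⟨
    MCM (℘ b)                   ∎
  ... | no  ℘b≉0 = begin
    δ b                             ≈⟨ *-identityʳ _ ⟨
    δ b * 1#                        ≈⟨ *-congˡ (*-inverseʳ (^-≉0 q ℘b≉0)) ⟨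
    δ b * (℘ b ^ q * (℘ b ^ q) ⁻¹)  ≈⟨ *-assoc _ _ _ ⟨
    δ b * ℘ b ^ q * (℘ b ^ q) ⁻¹    ≈⟨ *-congʳ (δ-*-℘^q b) ⟩
    MCM (℘ b)                       ∎

-- Additive characters

module CharacterSums {c ℓ} (n k : ℕ) (0<n : 0 ℕ.< n) (𝔽 : FiniteField c ℓ (2 ℕ.^ n)) where
  open FiniteField 𝔽 hiding (zero)
  open FieldProperties 𝔽
  open Kasami n k 𝔽
  open KasamiProperties n k 0<n 𝔽
  open ℤSolver.+-*-Solver using () renaming (solve to ℤ-solve; _:*_ to _:*ℤ_; _:=_ to _:=ℤ_)
  open ≡.≡-Reasoning

  χ-Tr≈0 : ∀ {x} → Tr x ≈ 0# → χ x ≡ 1ℤ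
  χ-Tr≈0 {x} Tr≈0 = ≡.cong (-1ℤ ℤ.^_) (if-yes (Tr x ≟ 0#) Tr≈0)

  χ-Tr≉0 : ∀ {x} → Tr x ≉ 0# → χ x ≡ -1ℤ
  χ-Tr≉0 {x} Tr≉0 = ≡.cong (-1ℤ ℤ.^_) (if-no (Tr x ≟ 0#) Tr≉0)

  χ-cong : ∀ {x y} → x ≈ y → χ x ≡ χ y
  χ-cong {x} {y} x≈y with Tr x ≟ 0#
  ... | yes Tr≈0 = ≡.trans (χ-Tr≈0 Tr≈0) (≡.sym (χ-Tr≈0 (trans (T-cong n (sym x≈y)) Tr≈0)))
  ... | no  Tr≉0 = ≡.trans (χ-Tr≉0 Tr≉0) (≡.sym (χ-Tr≉0 (Tr≉0 ∘ trans (T-cong n x≈y))))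

  χ-0 : ∀ {x} → x ≈ 0# → χ x ≡ 1ℤ
  χ-0 x≈0 = χ-Tr≈0 (trans
    -- 0 is rewritten as `℘ 0#`, whose trace is already known to vanish.
    (T-cong n (trans x≈0 (sym (trans (+-congʳ (zeroˡ 0#)) (+-identityˡ 0#)))))
    (Tr-℘ 0#))

  χ-+ : ∀ x y → χ (x + y) ≡ χ x ℤ.* χ y
  χ-+ x y with Tr x ≟ 0# | Tr y ≟ 0#
  ... | yes p | yes q = ≡.trans
    (χ-Tr≈0 (trans (T-+ n x y) (trans (+-cong p q) (+-identityˡ 0#))))
    (≡.sym (≡.cong₂ ℤ._*_ (χ-Tr≈0 p) (χ-Tr≈0 q)))
  ... | yes p | no  q = ≡.trans
    (χ-Tr≉0 (q ∘ trans (sym (trans (T-+ n x y) (trans (+-congʳ p) (+-identityˡ _))))))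
    (≡.sym (≡.cong₂ ℤ._*_ (χ-Tr≈0 p) (χ-Tr≉0 q)))
  ... | no  p | yes q = ≡.trans
    (χ-Tr≉0 (p ∘ trans (sym (trans (T-+ n x y) (trans (+-congˡ q) (+-identityʳ _))))))
    (≡.sym (≡.cong₂ ℤ._*_ (χ-Tr≉0 p) (χ-Tr≈0 q)))
  ... | no  p | no  q = ≡.trans
    (χ-Tr≈0 (trans (T-+ n x y) (trans (+-cong (Tr≉0⇒Tr≈1 p) (Tr≉0⇒Tr≈1 q)) 1+1≈0)))
    (≡.sym (≡.cong₂ ℤ._*_ (χ-Tr≉0 p) (χ-Tr≉0 q)))

  -- Translation by an element of trace 1 permutes the field and flips the sign of every value of χ.
  ∑χ≡0 : ∑ χ ≡ 0ℤ
  ∑χ≡0 = x≡-x⇒x≡0 (∑ χ) (begin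
    ∑ χ                    ≡⟨ ∑-reindex ℤₚ.+-0-commutativeMonoid (translation e e) χ-cong ⟩
    ∑ (λ x → χ (x + e))    ≡⟨ ∑-cong (λ x → ≡.trans (χ-+ x e) (≡.trans (≡.cong (χ x ℤ.*_) χe≡-1) (ℤₚ.*-comm (χ x) -1ℤ))) ⟩
    ∑ (λ x → -1ℤ ℤ.* χ x)  ≡⟨ ∑-*ˡ -1ℤ χ ⟨
    -1ℤ ℤ.* ∑ χ            ≡⟨ ℤₚ.-1*i≡-i (∑ χ) ⟩
    ℤ.- ∑ χ                ∎)
    where
    e = proj₁ Tr-surjective
    χe≡-1 : χ e ≡ -1ℤ
    χe≡-1 = χ-Tr≉0 λ Tr≈0 → 0≉1 (trans (sym Tr≈0) (proj₂ Tr-surjective))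
    x≡-x⇒x≡0 : ∀ x → x ≡ ℤ.- x → x ≡ 0ℤ
    -- For every other integer, x and -x are built from different constructors, so no further clause
    -- remains.
    x≡-x⇒x≡0 (+ 0) _ = ≡.refl

  ∑χ-0 : ∀ {a} → a ≈ 0# → ∑ (λ x → χ (x * a)) ≡ + (2 ℕ.^ n)
  ∑χ-0 {a} a≈0 = ≡.trans (∑-cong λ x → χ-0 {x * a} (trans (*-congˡ a≈0) (zeroʳ x))) ∑-1

  ∑χ-≉0 : ∀ {a} → a ≉ 0# → ∑ (λ x → χ (x * a)) ≡ 0ℤ
  ∑χ-≉0 {a} a≉0 = ≡.trans (∑-cong λ x → χ-cong (*-comm x a)) (≡.trans
    (≡.sym (∑-reindex ℤₚ.+-0-commutativeMonoid (scaling a≉0) χ-cong)) ∑χ≡0)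

  -- The Fourier transform on the additive group, with a free weight: `1Δ` yields `S`, and χ ∘ ψ
  -- yields `W ψ 1#`.
  transform : (Carrier → ℤ) → Carrier → ℤ
  transform w μ = ∑ λ x → w x ℤ.* χ (μ * x)

  transform-cong : ∀ w {μ ν} → μ ≈ ν → transform w μ ≡ transform w ν
  transform-cong w μ≈ν = ∑-cong λ x → ≡.cong (w x ℤ.*_) (χ-cong (*-congʳ {x} μ≈ν))

  -- Orthogonality of characters picks out the solutions of a x + b y + c z = 0.
  ∑-transform³ : ∀ w a b c →
    ∑ (λ μ → transform w (μ * a) ℤ.* transform w (μ * b) ℤ.* transform w (μ * c)) ≡
    + (2 ℕ.^ n) ℤ.* ∑³ (λ x y z → if does (a * x + b * y + c * z ≟ 0#)
                                  then w x ℤ.* w y ℤ.* w z else 0ℤ)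
  ∑-transform³ w a b c = begin
    ∑ (λ μ → transform w (μ * a) ℤ.* transform w (μ * b) ℤ.* transform w (μ * c))
      ≡⟨ ∑-cong (λ μ → ∑-product³ (term a μ) (term b μ) (term c μ)) ⟩
    ∑ (λ μ → ∑³ λ x y z → term a μ x ℤ.* term b μ y ℤ.* term c μ z)
      ≡⟨ ∑-swap³ (λ μ x y z → term a μ x ℤ.* term b μ y ℤ.* term c μ z) ⟩
    ∑³ (λ x y z → ∑ λ μ → term a μ x ℤ.* term b μ y ℤ.* term c μ z)
      ≡⟨ ∑³-cong (λ x y z → ∑-cong λ μ → collect μ x y z) ⟩
    ∑³ (λ x y z → ∑ λ μ → w³ x y z ℤ.* χ (μ * form x y z))
      ≡⟨ ∑³-cong (λ x y z → ∑-*ˡ (w³ x y z) λ μ → χ (μ * form x y z)) ⟨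
    ∑³ (λ x y z → w³ x y z ℤ.* ∑ λ μ → χ (μ * form x y z))
      ≡⟨ ∑³-cong orthogonality ⟩
    ∑³ (λ x y z → + (2 ℕ.^ n) ℤ.* selected x y z)
      ≡⟨ ∑³-*ˡ (+ (2 ℕ.^ n)) selected ⟨
    + (2 ℕ.^ n) ℤ.* ∑³ selected
      ∎
    where
    term : Carrier → Carrier → Carrier → ℤ
    term v μ x = w x ℤ.* χ (μ * v * x)
    form : Carrier → Carrier → Carrier → Carrier
    form x y z = a * x + b * y + c * z
    w³ selected : Carrier → Carrier → Carrier → ℤ
    w³ x y z = w x ℤ.* w y ℤ.* w z
    selected x y z = if does (form x y z ≟ 0#) then w³ x y z else 0ℤ
    χ-form : ∀ μ x y z →
      χ (μ * form x y z) ≡ χ (μ * a * x) ℤ.* χ (μ * b * y) ℤ.* χ (μ * c * z)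
    χ-form μ x y z = begin
      χ (μ * form x y z)
        ≡⟨ χ-cong (solve 7 (λ μ a b c x y z → μ :* (a :* x :+ b :* y :+ c :* z) :=
             μ :* a :* x :+ μ :* b :* y :+ μ :* c :* z) refl μ a b c x y z) ⟩
      χ (μ * a * x + μ * b * y + μ * c * z)
        ≡⟨ χ-+ (μ * a * x + μ * b * y) (μ * c * z) ⟩
      χ (μ * a * x + μ * b * y) ℤ.* χ (μ * c * z)
        ≡⟨ ≡.cong (ℤ._* χ (μ * c * z)) (χ-+ (μ * a * x) (μ * b * y)) ⟩
      χ (μ * a * x) ℤ.* χ (μ * b * y) ℤ.* χ (μ * c * z) ∎
    collect : ∀ μ x y z →
      term a μ x ℤ.* term b μ y ℤ.* term c μ z ≡ w³ x y z ℤ.* χ (μ * form x y z)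
    collect μ x y z = ≡.trans
      (ℤ-solve 6 (λ p q r u v t → p :*ℤ u :*ℤ (q :*ℤ v) :*ℤ (r :*ℤ t) :=ℤ p :*ℤ q :*ℤ r :*ℤ (u :*ℤ v :*ℤ t))
        ≡.refl (w x) (w y) (w z) (χ (μ * a * x)) (χ (μ * b * y)) (χ (μ * c * z)))
      (≡.cong (w³ x y z ℤ.*_) (≡.sym (χ-form μ x y z)))
    orthogonality : ∀ x y z →
      w³ x y z ℤ.* ∑ (λ μ → χ (μ * form x y z)) ≡ + (2 ℕ.^ n) ℤ.* selected x y z
    orthogonality x y z with form x y z ≟ 0#
    ... | yes p = begin
      w³ x y z ℤ.* ∑ (λ μ → χ (μ * form x y z))  ≡⟨ ≡.cong (w³ x y z ℤ.*_) (∑χ-0 p) ⟩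
      w³ x y z ℤ.* + (2 ℕ.^ n)                   ≡⟨ ℤₚ.*-comm (w³ x y z) (+ (2 ℕ.^ n)) ⟩
      + (2 ℕ.^ n) ℤ.* w³ x y z                   ≡⟨ ≡.cong (+ (2 ℕ.^ n) ℤ.*_) (if-yes (form x y z ≟ 0#) p) ⟨
      + (2 ℕ.^ n) ℤ.* selected x y z             ∎
    ... | no ¬p = begin
      w³ x y z ℤ.* ∑ (λ μ → χ (μ * form x y z))  ≡⟨ ≡.cong (w³ x y z ℤ.*_) (∑χ-≉0 ¬p) ⟩
      w³ x y z ℤ.* 0ℤ                            ≡⟨ ℤₚ.*-zeroʳ (w³ x y z) ⟩
      0ℤ                                         ≡⟨ ℤₚ.*-zeroʳ (+ (2 ℕ.^ n)) ⟨
      + (2 ℕ.^ n) ℤ.* 0ℤ                         ≡⟨ ≡.cong (+ (2 ℕ.^ n) ℤ.*_) (if-no (form x y z ≟ 0#) ¬p) ⟨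
      + (2 ℕ.^ n) ℤ.* selected x y z             ∎

-- Walsh coefficients and solution counts

module MCMSums {c ℓ} (n k : ℕ) (0<n : 0 ℕ.< n) (𝔽 : FiniteField c ℓ (2 ℕ.^ n))
  (ψ : FiniteField.Carrier 𝔽 → FiniteField.Carrier 𝔽)
  (ψ-inverse : Inverseᵇ (FiniteField._≈_ 𝔽) (FiniteField._≈_ 𝔽) (Kasami.MCM n k 𝔽) ψ) where
  open FiniteField 𝔽 hiding (zero)
  open FieldProperties 𝔽
  open Kasami n k 𝔽
  open KasamiProperties n k 0<n 𝔽
  open CharacterSums n k 0<n 𝔽
  open ℤSolver.+-*-Solver using () renaming
    (solve to ℤ-solve; _:*_ to _:*ℤ_; _:+_ to _:+ℤ_; _:=_ to _:=ℤ_; con to conℤ)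
  open ≡.≡-Reasoning

  -- `Inverseᵇ` speaks of every argument equivalent to a value of the other map, so the inverse laws
  -- by themselves force both maps to respect `_≈_`.
  ψ-cong : ∀ {x y} → x ≈ y → ψ x ≈ ψ y
  ψ-cong x≈y = proj₂ ψ-inverse (trans x≈y (sym (proj₁ ψ-inverse refl)))

  MCM-cong : ∀ {x y} → x ≈ y → MCM x ≈ MCM y
  MCM-cong x≈y = proj₁ ψ-inverse (trans x≈y (sym (proj₂ ψ-inverse refl)))

  ψ-MCM : ∀ x → ψ (MCM x) ≈ x
  ψ-MCM x = proj₂ ψ-inverse refl

  permutation : Inverse setoid setoid
  permutation = record
    { to = MCM ; from = ψ ; to-cong = MCM-cong ; from-cong = ψ-cong ; inverse = ψ-inverse }

  ∑-∘MCM : ∀ {f} → f Preserves _≈_ ⟶ _≡_ → ∑ f ≡ ∑ (λ x → f (MCM x))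
  ∑-∘MCM f-cong = ∑-reindex ℤₚ.+-0-commutativeMonoid permutation f-cong

  1Δ : Carrier → ℤ
  1Δ t = if does (Δ? t) then 1ℤ else 0ℤ

  1Δ-cong : ∀ {s t} → s ≈ t → 1Δ s ≡ 1Δ t
  1Δ-cong {s} {t} s≈t = ≡.cong (if_then 1ℤ else 0ℤ) (does-⇔
    (mk⇔ (λ (b , e) → b , trans e s≈t) (λ (b , e) → b , trans e (sym s≈t))) (Δ? s) (Δ? t))

  -- Doubled to stay in ℤ. For Tr y = 0, Hilbert 90 supplies the preimage under δ; conversely δ b =
  -- MCM y means MCM (℘ b) = MCM y, and applying ψ gives y = ℘ b, of trace 0.
  2*1Δ∘MCM : ∀ y → + 2 ℤ.* 1Δ (MCM y) ≡ 1ℤ ℤ.+ χ y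
  2*1Δ∘MCM y with Tr y ≟ 0#
  ... | yes Tr≈0 = ≡.trans
    (≡.cong (+ 2 ℤ.*_) (if-yes (Δ? (MCM y)) (b , trans (δ≈MCM∘℘ b) (MCM-cong ℘b≈y))))
    (≡.cong (ℤ._+_ 1ℤ) (≡.sym (χ-Tr≈0 Tr≈0)))
    where
    b = proj₁ (hilbert90 Tr≈0)
    ℘b≈y = proj₂ (hilbert90 Tr≈0)
  ... | no  Tr≉0 = ≡.trans
    (≡.cong (+ 2 ℤ.*_) (if-no (Δ? (MCM y)) λ (b , δb≈) → Tr≉0 (trans
      (T-cong n (trans (sym (ψ-MCM y)) (trans (ψ-cong (trans (sym δb≈) (δ≈MCM∘℘ b))) (ψ-MCM (℘ b)))))
      (Tr-℘ b))))
    (≡.cong (ℤ._+_ 1ℤ) (≡.sym (χ-Tr≉0 Tr≉0)))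

  S≡transform : ∀ μ → S μ ≡ transform 1Δ μ
  S≡transform μ = ∑-cong λ t → if-* (does (Δ? t)) (χ (μ * t))

  S-cong : ∀ {μ ν} → μ ≈ ν → S μ ≡ S ν
  S-cong {μ} {ν} μ≈ν = ≡.trans (S≡transform μ)
    (≡.trans (transform-cong 1Δ μ≈ν) (≡.sym (S≡transform ν)))

  -- The complete character sum stays unevaluated because both of its values matter: 0 for μ ≠ 0,
  -- and 2ⁿ for the term at μ = 0.
  2*S : ∀ μ → + 2 ℤ.* S μ ≡ ∑ (λ x → χ (x * μ)) ℤ.+ W MCM μ 1#
  2*S μ = begin
    + 2 ℤ.* S μ
      ≡⟨ ≡.cong (+ 2 ℤ.*_) (S≡transform μ) ⟩
    + 2 ℤ.* ∑ (λ t → 1Δ t ℤ.* χ (μ * t))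
      ≡⟨ ≡.cong (+ 2 ℤ.*_) (∑-∘MCM λ e → ≡.cong₂ ℤ._*_ (1Δ-cong e) (χ-cong (*-congˡ e))) ⟩
    + 2 ℤ.* ∑ (λ y → 1Δ (MCM y) ℤ.* χ (μ * MCM y))
      ≡⟨ ∑-*ˡ (+ 2) (λ y → 1Δ (MCM y) ℤ.* χ (μ * MCM y)) ⟩
    ∑ (λ y → + 2 ℤ.* (1Δ (MCM y) ℤ.* χ (μ * MCM y)))
      ≡⟨ ∑-cong pointwise ⟩
    ∑ (λ y → χ (MCM y * μ) ℤ.+ χ (μ * MCM y + 1# * y))
      ≡⟨ ∑-+ (λ y → χ (MCM y * μ)) (λ y → χ (μ * MCM y + 1# * y)) ⟩
    ∑ (λ y → χ (MCM y * μ)) ℤ.+ W MCM μ 1#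
      ≡⟨ ≡.cong (ℤ._+ W MCM μ 1#) (∑-∘MCM λ e → χ-cong (*-congʳ e)) ⟨
    ∑ (λ x → χ (x * μ)) ℤ.+ W MCM μ 1# ∎
    where
    pointwise : ∀ y → + 2 ℤ.* (1Δ (MCM y) ℤ.* χ (μ * MCM y)) ≡
                      χ (MCM y * μ) ℤ.+ χ (μ * MCM y + 1# * y)
    pointwise y = begin
      + 2 ℤ.* (1Δ (MCM y) ℤ.* χ (μ * MCM y))
        ≡⟨ ℤₚ.*-assoc (+ 2) (1Δ (MCM y)) (χ (μ * MCM y)) ⟨
      + 2 ℤ.* 1Δ (MCM y) ℤ.* χ (μ * MCM y)
        ≡⟨ ≡.cong (ℤ._* χ (μ * MCM y)) (2*1Δ∘MCM y) ⟩
      (1ℤ ℤ.+ χ y) ℤ.* χ (μ * MCM y)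
        ≡⟨ ℤ-solve 2 (λ u v → (conℤ 1ℤ :+ℤ u) :*ℤ v :=ℤ v :+ℤ v :*ℤ u) ≡.refl (χ y) (χ (μ * MCM y)) ⟩
      χ (μ * MCM y) ℤ.+ χ (μ * MCM y) ℤ.* χ y
        ≡⟨ ≡.cong₂ ℤ._+_ (χ-cong (*-comm μ (MCM y)))
             (≡.trans (≡.cong (χ (μ * MCM y) ℤ.*_) (χ-cong (sym (*-identityˡ y))))
                      (≡.sym (χ-+ (μ * MCM y) (1# * y)))) ⟩
      χ (MCM y * μ) ℤ.+ χ (μ * MCM y + 1# * y) ∎

  W-MCM≡2*S : ∀ μ → μ ≉ 0# → W MCM μ 1# ≡ + 2 ℤ.* S μ
  W-MCM≡2*S μ μ≉0 = begin
    W MCM μ 1#                            ≡⟨ ℤₚ.+-identityˡ (W MCM μ 1#) ⟨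
    0ℤ ℤ.+ W MCM μ 1#                     ≡⟨ ≡.cong (ℤ._+ W MCM μ 1#) (∑χ-≉0 μ≉0) ⟨
    ∑ (λ x → χ (x * μ)) ℤ.+ W MCM μ 1#    ≡⟨ 2*S μ ⟨
    + 2 ℤ.* S μ                           ∎

  W-MCM-0 : ∀ {μ} → μ ≈ 0# → W MCM μ 1# ≡ 0ℤ
  W-MCM-0 {μ} μ≈0 = ≡.trans
    (∑-cong λ x → χ-cong {μ * MCM x + 1# * x} {x}
      (trans (+-cong (trans (*-congʳ μ≈0) (zeroˡ _)) (*-identityˡ x)) (+-identityˡ x)))
    ∑χ≡0

  2*S-0 : + 2 ℤ.* S 0# ≡ + (2 ℕ.^ n)
  2*S-0 = begin
    + 2 ℤ.* S 0#                          ≡⟨ 2*S 0# ⟩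
    ∑ (λ x → χ (x * 0#)) ℤ.+ W MCM 0# 1#  ≡⟨ ≡.cong₂ ℤ._+_ (∑χ-0 refl) (W-MCM-0 refl) ⟩
    + (2 ℕ.^ n) ℤ.+ 0ℤ                    ≡⟨ ℤₚ.+-identityʳ (+ (2 ℕ.^ n)) ⟩
    + (2 ℕ.^ n)                           ∎

  W-ψ≡∑ : ∀ μ → W ψ 1# μ ≡ ∑ (λ x → χ (ψ x + μ * x))
  W-ψ≡∑ μ = ∑-cong λ x → χ-cong {1# * ψ x + μ * x} (+-congʳ (*-identityˡ (ψ x)))

  W-ψ≡W-MCM : ∀ μ → W ψ 1# μ ≡ W MCM μ 1#
  W-ψ≡W-MCM μ = ≡.trans
    (∑-∘MCM λ e → χ-cong (+-cong (*-congˡ (ψ-cong e)) (*-congˡ e)))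
    (∑-cong λ x → χ-cong {1# * ψ (MCM x) + μ * MCM x} {μ * MCM x + 1# * x}
      (trans (+-comm _ _) (+-congˡ (*-congˡ (ψ-MCM x)))))

  W-ψ≡transform : ∀ μ → W ψ 1# μ ≡ transform (λ x → χ (ψ x)) μ
  W-ψ≡transform μ = ≡.trans (W-ψ≡∑ μ) (∑-cong λ x → χ-+ (ψ x) (μ * x))

  W-ψ-cong : ∀ {μ ν} → μ ≈ ν → W ψ 1# μ ≡ W ψ 1# ν
  W-ψ-cong {μ} {ν} μ≈ν = ≡.trans (W-ψ≡transform μ)
    (≡.trans (transform-cong (λ x → χ (ψ x)) μ≈ν) (≡.sym (W-ψ≡transform ν)))

  -- In characteristic 2 the constraint solves to t₁ = ρ t₂ + σ t₃. With t₃ = t and t₂ = a + t this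
  -- becomes t + ρ a, since ρ + σ = 1.
  A≡∑∑ : ∀ ρ → A ψ ρ ≡ ∑ (λ t → ∑ (λ a → χ (ψ (t + ρ * a) + ψ (t + a) + ψ t)))
  A≡∑∑ ρ = begin
    ∑³ (λ t₁ t₂ t₃ → summand t₁ t₂ t₃)
      ≡⟨ ∑-swap (λ t₁ t₂ → ∑ λ t₃ → summand t₁ t₂ t₃) ⟩
    ∑ (λ t₂ → ∑ λ t₁ → ∑ λ t₃ → summand t₁ t₂ t₃)
      ≡⟨ ∑-cong (λ t₂ → ∑-swap λ t₁ t₃ → summand t₁ t₂ t₃) ⟩
    ∑ (λ t₂ → ∑ λ t₃ → ∑ λ t₁ → summand t₁ t₂ t₃)
      ≡⟨ ∑-cong (λ t₂ → ∑-cong λ t₃ → solve-t₁ t₂ t₃) ⟩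
    ∑ (λ t₂ → ∑ λ t₃ → χ (ψ (ρ * t₂ + σ * t₃) + ψ t₂ + ψ t₃))
      ≡⟨ ∑-swap (λ t₂ t₃ → χ (ψ (ρ * t₂ + σ * t₃) + ψ t₂ + ψ t₃)) ⟩
    ∑ (λ t → ∑ λ t₂ → χ (ψ (ρ * t₂ + σ * t) + ψ t₂ + ψ t))
      ≡⟨ ∑-cong (λ t → ∑-reindex ℤₚ.+-0-commutativeMonoid (translation t t) λ e →
           χ-cong (+-congʳ {ψ t} (+-cong (ψ-cong (+-congʳ {σ * t} (*-congˡ e))) (ψ-cong e)))) ⟩
    ∑ (λ t → ∑ λ a → χ (ψ (ρ * (a + t) + σ * t) + ψ (a + t) + ψ t))
      ≡⟨ ∑-cong (λ t → ∑-cong λ a → χ-cong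
           {ψ (ρ * (a + t) + σ * t) + ψ (a + t) + ψ t} {ψ (t + ρ * a) + ψ (t + a) + ψ t}
           (+-congʳ (+-cong (ψ-cong (solve 3 (λ ρ a t →
             ρ :* (a :+ t) :+ (con true :+ ρ) :* t := t :+ ρ :* a) refl ρ a t))
             (ψ-cong (+-comm a t))))) ⟩
    ∑ (λ t → ∑ (λ a → χ (ψ (t + ρ * a) + ψ (t + a) + ψ t))) ∎
    where
    σ = 1# + ρ
    summand : Carrier → Carrier → Carrier → ℤ
    summand t₁ t₂ t₃ = if does (t₁ + ρ * t₂ + σ * t₃ ≟ 0#)
                       then χ (ψ t₁ + ψ t₂ + ψ t₃) else 0ℤ
    summand-cong : ∀ {s t} t₂ t₃ → s ≈ t → summand s t₂ t₃ ≡ summand t t₂ t₃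
    summand-cong t₂ t₃ s≈t = ≡.cong₂ (λ b u → if b then u else 0ℤ)
      (does-⇔ (mk⇔ (trans (sym eq)) (trans eq)) (_ ≟ 0#) (_ ≟ 0#))
      (χ-cong (+-congʳ (+-congʳ (ψ-cong s≈t))))
      where eq = +-congʳ (+-congʳ s≈t)
    solve-t₁ : ∀ t₂ t₃ → ∑ (λ t₁ → summand t₁ t₂ t₃) ≡ χ (ψ (ρ * t₂ + σ * t₃) + ψ t₂ + ψ t₃)
    solve-t₁ t₂ t₃ = ≡.trans
      (∑-single ℤₚ.+-0-commutativeMonoid (ρ * t₂ + σ * t₃) (summand-cong t₂ t₃)
        λ t₁ t₁≉ → if-no (t₁ + ρ * t₂ + σ * t₃ ≟ 0#)
          λ e → t₁≉ (+≈0⇒≈ (trans (sym (+-assoc _ _ _)) e)))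
      (if-yes (ρ * t₂ + σ * t₃ + ρ * t₂ + σ * t₃ ≟ 0#)
        (solve 2 (λ u v → u :+ v :+ u :+ v := con false) refl (ρ * t₂) (σ * t₃)))

  ∑W³≡2^n*A : ∀ ρ → ∑ (λ μ → W ψ 1# μ ℤ.* W ψ 1# (μ * ρ) ℤ.* W ψ 1# (μ * (1# + ρ))) ≡
                    + (2 ℕ.^ n) ℤ.* A ψ ρ
  ∑W³≡2^n*A ρ = begin
    ∑ (λ μ → W ψ 1# μ ℤ.* W ψ 1# (μ * ρ) ℤ.* W ψ 1# (μ * σ))
      ≡⟨ ∑-cong (λ μ → ≡.cong₂ ℤ._*_ (≡.cong₂ ℤ._*_
           (≡.trans (W-ψ-cong (sym (*-identityʳ μ))) (W-ψ≡transform (μ * 1#)))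
           (W-ψ≡transform (μ * ρ))) (W-ψ≡transform (μ * σ))) ⟩
    ∑ (λ μ → transform w (μ * 1#) ℤ.* transform w (μ * ρ) ℤ.* transform w (μ * σ))
      ≡⟨ ∑-transform³ w 1# ρ σ ⟩
    + (2 ℕ.^ n) ℤ.* ∑³ (λ t₁ t₂ t₃ → if does (1# * t₁ + ρ * t₂ + σ * t₃ ≟ 0#)
                                     then w t₁ ℤ.* w t₂ ℤ.* w t₃ else 0ℤ)
      ≡⟨ ≡.cong (+ (2 ℕ.^ n) ℤ.*_) (∑³-cong λ t₁ t₂ t₃ →
           let eq = +-congʳ {σ * t₃} (+-congʳ {ρ * t₂} (*-identityˡ t₁)) in
           ≡.cong₂ (λ b u → if b then u else 0ℤ)
             (does-⇔ (mk⇔ (trans (sym eq)) (trans eq)) (_ ≟ 0#) (_ ≟ 0#))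
             (≡.sym (≡.trans (χ-+ (ψ t₁ + ψ t₂) (ψ t₃)) (≡.cong (ℤ._* w t₃) (χ-+ (ψ t₁) (ψ t₂)))))) ⟩
    + (2 ℕ.^ n) ℤ.* A ψ ρ ∎
    where
    σ = 1# + ρ
    w : Carrier → ℤ
    w x = χ (ψ x)

  1+≉0 : ∀ {ρ} → ρ ≉ 1# → 1# + ρ ≉ 0#
  1+≉0 ρ≉1 1+ρ≈0 = ρ≉1 (sym (+≈0⇒≈ 1+ρ≈0))

  -- The 8 supplies one factor 2 to each S. For l ≠ 0 all three arguments are nonzero, because ρ and
  -- σ are, and W = 2 S applies; the term l = 0 omitted from Z costs nothing, as W vanishes at 0.
  8*Z≡2^n*A : ∀ ρ → ρ ≉ 0# → ρ ≉ 1# → + 8 ℤ.* Z ρ ≡ + (2 ℕ.^ n) ℤ.* A ψ ρ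
  8*Z≡2^n*A ρ ρ≉0 ρ≉1 = begin
    + 8 ℤ.* Z ρ                                        ≡⟨ ∑-*ˡ (+ 8) nonzeroTerm ⟩
    ∑ (λ l → + 8 ℤ.* nonzeroTerm l)                    ≡⟨ ∑-cong pointwise ⟩
    ∑ (λ l → w l ℤ.* w (l * ρ) ℤ.* w (l * σ))          ≡⟨ ∑W³≡2^n*A ρ ⟩
    + (2 ℕ.^ n) ℤ.* A ψ ρ                              ∎
    where
    σ = 1# + ρ
    w nonzeroTerm : Carrier → ℤ
    w = W ψ 1#
    nonzeroTerm l = if does (l ≟ 0#) then 0ℤ else S l ℤ.* S (l * ρ) ℤ.* S (l * σ)
    w≡2*S : ∀ {μ} → μ ≉ 0# → w μ ≡ + 2 ℤ.* S μ
    w≡2*S {μ} μ≉0 = ≡.trans (W-ψ≡W-MCM μ) (W-MCM≡2*S μ μ≉0)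
    pointwise : ∀ l → + 8 ℤ.* nonzeroTerm l ≡ w l ℤ.* w (l * ρ) ℤ.* w (l * σ)
    pointwise l with l ≟ 0#
    ... | yes l≈0 = begin
      + 8 ℤ.* nonzeroTerm l                ≡⟨ ≡.cong (+ 8 ℤ.*_) (if-yes (l ≟ 0#) l≈0) ⟩
      0ℤ ℤ.* w (l * ρ) ℤ.* w (l * σ)       ≡⟨ ≡.cong (λ z → z ℤ.* w (l * ρ) ℤ.* w (l * σ))
                                                (≡.trans (W-ψ≡W-MCM l) (W-MCM-0 l≈0)) ⟨
      w l ℤ.* w (l * ρ) ℤ.* w (l * σ)      ∎
    ... | no  l≉0 = begin
      + 8 ℤ.* nonzeroTerm l
        ≡⟨ ≡.cong (+ 8 ℤ.*_) (if-no (l ≟ 0#) l≉0) ⟩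
      + 8 ℤ.* (S l ℤ.* S (l * ρ) ℤ.* S (l * σ))
        ≡⟨ ℤ-solve 3 (λ x y z → conℤ (+ 8) :*ℤ (x :*ℤ y :*ℤ z) :=ℤ
             conℤ (+ 2) :*ℤ x :*ℤ (conℤ (+ 2) :*ℤ y) :*ℤ (conℤ (+ 2) :*ℤ z))
             ≡.refl (S l) (S (l * ρ)) (S (l * σ)) ⟩
      + 2 ℤ.* S l ℤ.* (+ 2 ℤ.* S (l * ρ)) ℤ.* (+ 2 ℤ.* S (l * σ))
        ≡⟨ ≡.cong₂ ℤ._*_ (≡.cong₂ ℤ._*_ (w≡2*S l≉0) (w≡2*S (*-≉0 l≉0 ρ≉0)))
                         (w≡2*S (*-≉0 l≉0 (1+≉0 ρ≉1))) ⟨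
      w l ℤ.* w (l * ρ) ℤ.* w (l * σ) ∎

  -- Counting solutions in Δ

  2^n*N : ∀ v₁ v₂ → + (2 ℕ.^ n) ℤ.* + N v₁ v₂ ≡
          ∑ (λ μ → S (μ * v₁) ℤ.* S (μ * v₂) ℤ.* S (μ * (v₁ + v₂)))
  2^n*N v₁ v₂ = begin
    + (2 ℕ.^ n) ℤ.* + N v₁ v₂
      ≡⟨ ≡.cong (+ (2 ℕ.^ n) ℤ.*_) cast ⟩
    + (2 ℕ.^ n) ℤ.* ∑³ (λ x y z → + count x y z)
      ≡⟨ ≡.cong (+ (2 ℕ.^ n) ℤ.*_) (∑³-cong λ x y z →
           if-∧ (does (Δ? x)) (does (Δ? y)) (does (Δ? z)) (does (v₁ * x + v₂ * y + (v₁ + v₂) * z ≟ 0#))) ⟩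
    + (2 ℕ.^ n) ℤ.* ∑³ (λ x y z → if does (v₁ * x + v₂ * y + (v₁ + v₂) * z ≟ 0#)
                                  then 1Δ x ℤ.* 1Δ y ℤ.* 1Δ z else 0ℤ)
      ≡⟨ ∑-transform³ 1Δ v₁ v₂ (v₁ + v₂) ⟨
    ∑ (λ μ → transform 1Δ (μ * v₁) ℤ.* transform 1Δ (μ * v₂) ℤ.* transform 1Δ (μ * (v₁ + v₂)))
      ≡⟨ ∑-cong (λ μ → ≡.cong₂ ℤ._*_
           (≡.cong₂ ℤ._*_ (S≡transform (μ * v₁)) (S≡transform (μ * v₂)))
           (S≡transform (μ * (v₁ + v₂)))) ⟨
    ∑ (λ μ → S (μ * v₁) ℤ.* S (μ * v₂) ℤ.* S (μ * (v₁ + v₂))) ∎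
    where
    count : Carrier → Carrier → Carrier → ℕ
    count x y z = if does (Δ? x ×-dec Δ? y ×-dec Δ? z ×-dec
                           (v₁ * x + v₂ * y + (v₁ + v₂) * z ≟ 0#)) then 1 else 0
    cast : + N v₁ v₂ ≡ ∑³ (λ x y z → + count x y z)
    cast = ≡.trans (+∑ℕ λ x → ∑ℕ λ y → ∑ℕ λ z → count x y z) (∑-cong λ x →
      ≡.trans (+∑ℕ λ y → ∑ℕ λ z → count x y z) (∑-cong λ y → +∑ℕ (count x y)))

  -- The term at 0 is missing from Z.
  ∑S³≡S0³+Z : ∀ {v₁ v₂ ρ} → v₁ ≉ 0# → v₁ * ρ ≈ v₂ →
    ∑ (λ μ → S (μ * v₁) ℤ.* S (μ * v₂) ℤ.* S (μ * (v₁ + v₂))) ≡ S 0# ℤ.* S 0# ℤ.* S 0# ℤ.+ Z ρ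
  ∑S³≡S0³+Z {v₁} {v₂} {ρ} v₁≉0 v₁ρ≈v₂ = begin
    ∑ (λ μ → S (μ * v₁) ℤ.* S (μ * v₂) ℤ.* S (μ * (v₁ + v₂)))
      ≡⟨ ∑-cong (λ μ → ≡.cong₂ ℤ._*_ (≡.cong₂ ℤ._*_
           (S-cong (*-comm μ v₁))
           (S-cong (trans (*-congˡ (sym v₁ρ≈v₂)) (solve 3
             (λ μ v ρ → μ :* (v :* ρ) := v :* μ :* ρ) refl μ v₁ ρ))))
           (S-cong (trans (*-congˡ (+-congˡ (sym v₁ρ≈v₂))) (solve 3
             (λ μ v ρ → μ :* (v :+ v :* ρ) := v :* μ :* (con true :+ ρ)) refl μ v₁ ρ)))) ⟩
    -- The three frequencies are v₁ μ times 1, ρ and σ, so rescaling μ by v₁ reduces the pair (v₁,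
    -- v₂) to its ratio.
    ∑ (λ μ → term (v₁ * μ))
      ≡⟨ ∑-reindex ℤₚ.+-0-commutativeMonoid (scaling v₁≉0) term-cong ⟨
    ∑ term
      ≡⟨ ∑-cong split ⟩
    ∑ (λ μ → zeroTerm μ ℤ.+ nonzeroTerm μ)
      ≡⟨ ∑-+ zeroTerm nonzeroTerm ⟩
    ∑ zeroTerm ℤ.+ Z ρ
      ≡⟨ ≡.cong (ℤ._+ Z ρ) (∑-single ℤₚ.+-0-commutativeMonoid 0# zeroTerm-cong
           λ μ μ≉0 → if-no (μ ≟ 0#) μ≉0) ⟩
    zeroTerm 0# ℤ.+ Z ρ
      ≡⟨ ≡.cong (ℤ._+ Z ρ) (≡.trans (if-yes (0# ≟ 0#) refl) (≡.cong₂ ℤ._*_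
           (≡.cong (S 0# ℤ.*_) (S-cong (zeroˡ ρ))) (S-cong (zeroˡ (1# + ρ))))) ⟩
    S 0# ℤ.* S 0# ℤ.* S 0# ℤ.+ Z ρ ∎
    where
    term zeroTerm nonzeroTerm : Carrier → ℤ
    term μ = S μ ℤ.* S (μ * ρ) ℤ.* S (μ * (1# + ρ))
    zeroTerm μ = if does (μ ≟ 0#) then term μ else 0ℤ
    nonzeroTerm μ = if does (μ ≟ 0#) then 0ℤ else term μ
    term-cong : ∀ {μ ν} → μ ≈ ν → term μ ≡ term ν
    term-cong e = ≡.cong₂ ℤ._*_ (≡.cong₂ ℤ._*_ (S-cong e) (S-cong (*-congʳ e))) (S-cong (*-congʳ e))
    zeroTerm-cong : ∀ {μ ν} → μ ≈ ν → zeroTerm μ ≡ zeroTerm ν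
    zeroTerm-cong {μ} {ν} e = ≡.cong₂ (λ b u → if b then u else 0ℤ)
      (does-⇔ (mk⇔ (trans (sym e)) (trans e)) (μ ≟ 0#) (ν ≟ 0#)) (term-cong e)
    split : ∀ μ → term μ ≡ zeroTerm μ ℤ.+ nonzeroTerm μ
    split μ with does (μ ≟ 0#)
    ... | true  = ≡.sym (ℤₚ.+-identityʳ (term μ))
    ... | false = ≡.sym (ℤₚ.+-identityˡ (term μ))

  -- With M = 2ⁿ, multiplying by M gives (2 S(0))³ + 8 Z = M³ + M A, and M cancels. Describing ρ by
  -- `v₁ * ρ ≈ v₂` serves both the pair (1, ρ) and the quotient `v₁ ⁻¹ * v₂`.
  8*N : ∀ {v₁ v₂ ρ} → v₁ ≉ 0# → v₁ * ρ ≈ v₂ → ρ ≉ 0# → ρ ≉ 1# →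
        + 8 ℤ.* + N v₁ v₂ ≡ + (2 ℕ.^ n) ℤ.* + (2 ℕ.^ n) ℤ.+ A ψ ρ
  8*N {v₁} {v₂} {ρ} v₁≉0 v₁ρ≈v₂ ρ≉0 ρ≉1 =
    ℤₚ.*-cancelˡ-≡ M (+ 8 ℤ.* + N v₁ v₂) (M ℤ.* M ℤ.+ A ψ ρ) {{m^n≢0 2 n}} (begin
    M ℤ.* (+ 8 ℤ.* + N v₁ v₂)
      ≡⟨ ℤ-solve 2 (λ m x → m :*ℤ (conℤ (+ 8) :*ℤ x) :=ℤ conℤ (+ 8) :*ℤ (m :*ℤ x)) ≡.refl M (+ N v₁ v₂) ⟩
    + 8 ℤ.* (M ℤ.* + N v₁ v₂)
      ≡⟨ ≡.cong (+ 8 ℤ.*_) (≡.trans (2^n*N v₁ v₂) (∑S³≡S0³+Z v₁≉0 v₁ρ≈v₂)) ⟩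
    + 8 ℤ.* (S 0# ℤ.* S 0# ℤ.* S 0# ℤ.+ Z ρ)
      ≡⟨ ℤ-solve 2 (λ s z → conℤ (+ 8) :*ℤ (s :*ℤ s :*ℤ s :+ℤ z) :=ℤ
           conℤ (+ 2) :*ℤ s :*ℤ (conℤ (+ 2) :*ℤ s) :*ℤ (conℤ (+ 2) :*ℤ s) :+ℤ conℤ (+ 8) :*ℤ z)
           ≡.refl (S 0#) (Z ρ) ⟩
    + 2 ℤ.* S 0# ℤ.* (+ 2 ℤ.* S 0#) ℤ.* (+ 2 ℤ.* S 0#) ℤ.+ + 8 ℤ.* Z ρ
      ≡⟨ ≡.cong₂ (λ s z → s ℤ.* s ℤ.* s ℤ.+ z) 2*S-0 (8*Z≡2^n*A ρ ρ≉0 ρ≉1) ⟩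
    M ℤ.* M ℤ.* M ℤ.+ M ℤ.* A ψ ρ
      ≡⟨ ℤ-solve 2 (λ m a → m :*ℤ m :*ℤ m :+ℤ m :*ℤ a :=ℤ m :*ℤ (m :*ℤ m :+ℤ a)) ≡.refl M (A ψ ρ) ⟩
    M ℤ.* (M ℤ.* M ℤ.+ A ψ ρ) ∎)
    where M = + (2 ℕ.^ n)

  -- The exponent is a truncated subtraction: at n = 1 it would be 0, and the two sides would be 8
  -- and 4.
  8*2^[2n∸3] : 2 ≤ n → + 8 ℤ.* + (2 ℕ.^ (2 ℕ.* n ∸ 3)) ≡ + (2 ℕ.^ n) ℤ.* + (2 ℕ.^ n)
  8*2^[2n∸3] 2≤n = begin
    + 8 ℤ.* + (2 ℕ.^ (2 ℕ.* n ∸ 3))   ≡⟨ ℤₚ.pos-* 8 (2 ℕ.^ (2 ℕ.* n ∸ 3)) ⟨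
    + (8 ℕ.* 2 ℕ.^ (2 ℕ.* n ∸ 3))     ≡⟨ ≡.cong +_ (ℕₚ.^-distribˡ-+-* 2 3 (2 ℕ.* n ∸ 3)) ⟨
    + (2 ℕ.^ (3 ℕ.+ (2 ℕ.* n ∸ 3)))   ≡⟨ ≡.cong (λ m → + (2 ℕ.^ m)) (ℕₚ.m+[n∸m]≡n 3≤2n) ⟩
    + (2 ℕ.^ (2 ℕ.* n))               ≡⟨ ≡.cong (λ m → + (2 ℕ.^ (n ℕ.+ m))) (ℕₚ.+-identityʳ n) ⟩
    + (2 ℕ.^ (n ℕ.+ n))               ≡⟨ ≡.cong +_ (ℕₚ.^-distribˡ-+-* 2 n n) ⟩
    + (2 ℕ.^ n ℕ.* 2 ℕ.^ n)           ≡⟨ ℤₚ.pos-* (2 ℕ.^ n) (2 ℕ.^ n) ⟩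
    + (2 ℕ.^ n) ℤ.* + (2 ℕ.^ n)       ∎
    where
    3≤2n : 3 ≤ 2 ℕ.* n
    3≤2n = ℕₚ.≤-trans (ℕₚ.n≤1+n 3) (ℕₚ.*-monoʳ-≤ 2 2≤n)

  N≡2^[2n∸3]⇔A≡0 : 2 ≤ n →
    (∀ v₁ v₂ → v₁ ≉ 0# → v₂ ≉ 0# → v₁ ≉ v₂ → N v₁ v₂ ≡ 2 ℕ.^ (2 ℕ.* n ∸ 3)) ⇔
    (∀ ρ → ρ ≉ 0# → ρ ≉ 1# → A ψ ρ ≡ 0ℤ)
  N≡2^[2n∸3]⇔A≡0 2≤n = mk⇔ N⇒A A⇒N
    where
    M² = + (2 ℕ.^ n) ℤ.* + (2 ℕ.^ n)
    N⇒A : (∀ v₁ v₂ → v₁ ≉ 0# → v₂ ≉ 0# → v₁ ≉ v₂ → N v₁ v₂ ≡ 2 ℕ.^ (2 ℕ.* n ∸ 3)) →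
          ∀ ρ → ρ ≉ 0# → ρ ≉ 1# → A ψ ρ ≡ 0ℤ
    N⇒A N≡ ρ ρ≉0 ρ≉1 = ∙-cancelˡ M² (A ψ ρ) 0ℤ (begin
      -- Every admissible ρ is the ratio of the pair (1, ρ), which is nonzero and distinct precisely
      -- because ρ is neither 0 nor 1.
      M² ℤ.+ A ψ ρ                      ≡⟨ 8*N (0≉1 ∘ sym) (*-identityˡ ρ) ρ≉0 ρ≉1 ⟨
      + 8 ℤ.* + N 1# ρ                  ≡⟨ ≡.cong (λ m → + 8 ℤ.* + m) (N≡ 1# ρ (0≉1 ∘ sym) ρ≉0 (ρ≉1 ∘ sym)) ⟩
      + 8 ℤ.* + (2 ℕ.^ (2 ℕ.* n ∸ 3))   ≡⟨ 8*2^[2n∸3] 2≤n ⟩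
      M²                                ≡⟨ ℤₚ.+-identityʳ M² ⟨
      M² ℤ.+ 0ℤ                         ∎)
      where open GroupProperties (AbelianGroup.group ℤₚ.+-0-abelianGroup) using (∙-cancelˡ)
    A⇒N : (∀ ρ → ρ ≉ 0# → ρ ≉ 1# → A ψ ρ ≡ 0ℤ) →
          ∀ v₁ v₂ → v₁ ≉ 0# → v₂ ≉ 0# → v₁ ≉ v₂ → N v₁ v₂ ≡ 2 ℕ.^ (2 ℕ.* n ∸ 3)
    A⇒N A≡0 v₁ v₂ v₁≉0 v₂≉0 v₁≉v₂ = ℤₚ.+-injective (ℤₚ.*-cancelˡ-≡ (+ 8) _ _ (begin
      + 8 ℤ.* + N v₁ v₂                 ≡⟨ 8*N v₁≉0 v₁ρ≈v₂ ρ≉0 ρ≉1 ⟩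
      M² ℤ.+ A ψ ρ                      ≡⟨ ≡.cong (λ a → M² ℤ.+ a) (A≡0 ρ ρ≉0 ρ≉1) ⟩
      M² ℤ.+ 0ℤ                         ≡⟨ ℤₚ.+-identityʳ M² ⟩
      M²                                ≡⟨ 8*2^[2n∸3] 2≤n ⟨
      + 8 ℤ.* + (2 ℕ.^ (2 ℕ.* n ∸ 3))   ∎))
      where
      ρ = v₁ ⁻¹ * v₂
      v₁ρ≈v₂ : v₁ * ρ ≈ v₂
      v₁ρ≈v₂ = trans (sym (*-assoc _ _ _)) (trans (*-congʳ (*-inverseʳ v₁≉0)) (*-identityˡ v₂))
      ρ≉0 : ρ ≉ 0#
      ρ≉0 ρ≈0 = v₂≉0 (trans (sym v₁ρ≈v₂) (trans (*-congˡ ρ≈0) (zeroʳ v₁)))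
      ρ≉1 : ρ ≉ 1#
      ρ≉1 ρ≈1 = v₁≉v₂ (trans (sym (*-identityʳ v₁)) (trans (*-congˡ (sym ρ≈1)) v₁ρ≈v₂))

-- Fractions in ℚ are kept in lowest terms, so the equation is checked by cross-multiplying
-- unnormalised ones. It turns an identity for 2ⁿ A into one for A as a quotient by 2ⁿ.
/1≡[m*]/m : ∀ i m .{{_ : ℕ.NonZero m}} → i ℚ./ 1 ≡ (+ m ℤ.* i) ℚ./ m
/1≡[m*]/m i (ℕ.suc m) = ℚₚ.fromℚᵘ-cong {ℚᵘ.mkℚᵘ i 0} {ℚᵘ.mkℚᵘ (+ ℕ.suc m ℤ.* i) m}
  (ℚᵘ.*≡* (≡.trans (ℤₚ.*-comm i (+ ℕ.suc m)) (≡.sym (ℤₚ.*-identityʳ _))))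

theorem6p1 : ∀ {c ℓ} (n k : ℕ) (𝔽 : FiniteField c ℓ (2 ℕ.^ n)) →
  let open FiniteField 𝔽
      open Kasami n k 𝔽
  in
  1 ≤ k → k ≤ n ∸ 1 → gcd k n ≡ 1 → k % 2 ≡ 1 →
  (ψ : Carrier → Carrier) → Inverseᵇ _≈_ _≈_ MCM ψ →
  (∀ ρ → ρ ≉ 0# → ρ ≉ 1# →
     A ψ ρ ≡ ∑ (λ t → ∑ (λ a → χ (ψ (t + ρ * a) + ψ (t + a) + ψ t))))
  × (∀ ρ → ρ ≉ 0# → ρ ≉ 1# → + 8 ℤ.* Z ρ ≡ + (2 ℕ.^ n) ℤ.* A ψ ρ)
  × ((∀ v₁ v₂ → v₁ ≉ 0# → v₂ ≉ 0# → v₁ ≉ v₂ → N v₁ v₂ ≡ 2 ℕ.^ (2 ℕ.* n ∸ 3))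
     ⇔ (∀ ρ → ρ ≉ 0# → ρ ≉ 1# → A ψ ρ ≡ 0ℤ))
  × (∀ μ → W ψ 1# μ ≡ ∑ (λ x → χ (ψ x + μ * x)))
  × (∀ μ → W ψ 1# μ ≡ W MCM μ 1#)
  × (∀ μ → μ ≉ 0# → W MCM μ 1# ≡ + 2 ℤ.* S μ)
  × (∀ ρ → ρ ≉ 0# → ρ ≉ 1# →
     A ψ ρ ℚ./ 1 ≡
     ℚ._/_ (∑ (λ μ → W ψ 1# μ ℤ.* W ψ 1# (μ * ρ) ℤ.* W ψ 1# (μ * (1# + ρ))))
           (2 ℕ.^ n) {{m^n≢0 2 n}})
theorem6p1 n k 𝔽 1≤k k≤n∸1 _ _ ψ ψ-inverse =
  (λ ρ _ _ → A≡∑∑ ρ) , 8*Z≡2^n*A , N≡2^[2n∸3]⇔A≡0 2≤n ,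
  W-ψ≡∑ , W-ψ≡W-MCM , W-MCM≡2*S ,
  λ ρ _ _ → ≡.trans (/1≡[m*]/m (A ψ ρ) (2 ℕ.^ n))
    (≡.cong (λ z → z ℚ./ (2 ℕ.^ n)) (≡.sym (∑W³≡2^n*A ρ)))
  where
  open Kasami n k 𝔽 using (A)
  1≤m∸1⇒2≤m : ∀ {m} → 1 ≤ m ∸ 1 → 2 ≤ m
  1≤m∸1⇒2≤m {ℕ.suc _} = ℕ.s≤s
  2≤n : 2 ≤ n
  -- The range 1 ≤ k ≤ n ∸ 1 supplies n ≥ 2, which both the trace argument (n > 0) and the exponent
  -- 2n ∸ 3 rely on.
  2≤n = 1≤m∸1⇒2≤m (ℕₚ.≤-trans 1≤k k≤n∸1)
  open MCMSums n k (ℕₚ.<⇒≤ 2≤n) 𝔽 ψ ψ-inverse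
  instance
    2^n≢0 : ℕ.NonZero (2 ℕ.^ n)
    2^n≢0 = m^n≢0 2 n
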